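{- $$\sum_{k=0}^\infty\frac{(-1)^k}{\binom{2k}{k}^5}\left(684700k^4-1418358k^3+1100639k^2-365392k+47327\right)=\frac{231168-64\zeta(3)}{5}.$$
   Context: $\zeta(3)=\sum_{n=1}^\infty n^{ -3}$. -}

module Defs where

open import Data.Integer.Base as ℤ using (ℤ; +_; -1ℤ)
open import Data.Nat.Base as ℕ using (ℕ; zero; suc)
import Data.Nat.Properties as ℕ
import Data.Nat.DivMod as ℕ
import Data.Nat.Divisibility as ℕ
open import Data.Nat.Combinatorics using (_C_; k![n∸k]!∣n!)
open import Data.Nat.Combinatorics.Specification using (nCk≡n!/k![n-k]!)
open import Data.Product.Base using (_×_; _,_; ∃-syntax)
open import Data.Rational.Base as ℚ using (ℚ; 0ℚ; 1ℚ; mkℚ)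
import Data.Rational.Properties as ℚ
import Data.Rational.Unnormalised.Base as ℚᵘ
import Data.Rational.Unnormalised.Properties as ℚᵘ
open import Data.Nat.Solver renaming (module +-*-Solver to ℕ-Solver)
open import Data.Rational.Solver using (module +-*-Solver)
import Data.Integer.Properties as ℤ
open import Data.Sum.Base using (inj₁; inj₂)
open import Relation.Binary.PropositionalEquality

IsCauchy : (ℕ → ℚ) → Set
IsCauchy x = ∀ ε → 0ℚ ℚ.< ε →
  ∃[ N ] (∀ m n → N ℕ.≤ m → N ℕ.≤ n → ℚ.∣ x m ℚ.- x n ∣ ℚ.< ε)

record ℝ : Set where
  constructor mkℝ
  field
    seq    : ℕ → ℚ
    cauchy : IsCauchy seq

open ℝ public

infix  4 _<_
infixl 6 _-_
infixr 7 _·_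

-- Elements of ℝ are representing sequences, not equivalence classes.  The uniform
-- gap δ makes this strict in the limit, hence independent of representatives.
_<_ : ℝ → ℝ → Set
x < y = ∃[ δ ] (0ℚ ℚ.< δ ×
  ∃[ N ] (∀ n → N ℕ.≤ n → seq x n ℚ.+ δ ℚ.≤ seq y n))

fromℚ : ℚ → ℝ
fromℚ q = mkℝ (λ _ → q) λ ε 0<ε → 0 , λ _ _ _ _ →
  subst (λ z → ℚ.∣ z ∣ ℚ.< ε) (sym (ℚ.+-inverseʳ q)) 0<ε

fromℤ : ℤ → ℚ
fromℤ i = i ℚ./ 1

private
  open +-*-Solver using (solve; _:+_; _:*_; :-_; _:=_; con; _:-_)

  sub-swap : ∀ a b c d → (a ℚ.- b) ℚ.- (c ℚ.- d) ≡ (a ℚ.- c) ℚ.- (b ℚ.- d)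
  sub-swap = solve 4 (λ a b c d →
    (a :- b) :- (c :- d) := (a :- c) :- (b :- d)) refl

  half+half : ∀ ε → ℚ.½ ℚ.* ε ℚ.+ ℚ.½ ℚ.* ε ≡ ε
  half+half = solve 1 (λ ε → con ℚ.½ :* ε :+ con ℚ.½ :* ε := ε) refl

  half-pos : ∀ ε → 0ℚ ℚ.< ε → 0ℚ ℚ.< ℚ.½ ℚ.* ε
  half-pos ε 0<ε = subst (ℚ._< ℚ.½ ℚ.* ε) (ℚ.*-zeroʳ ℚ.½)
    (ℚ.*-monoʳ-<-pos ℚ.½ 0<ε)

  ∣-∣-swap : ∀ p q → ℚ.∣ p ℚ.- q ∣ ≡ ℚ.∣ q ℚ.- p ∣
  ∣-∣-swap p q = trans (sym (ℚ.∣-p∣≡∣p∣ (p ℚ.- q)))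
    (cong ℚ.∣_∣ (solve 2 (λ p q → :- (p :- q) := q :- p) refl p q))

  ∣∣-bound : ∀ p q {r} → p ℚ.- q ℚ.≤ r → q ℚ.- p ℚ.≤ r → ℚ.∣ p ℚ.- q ∣ ℚ.≤ r
  ∣∣-bound p q {r} p-q≤r q-p≤r with ℚ.∣p∣≡p∨∣p∣≡-p (p ℚ.- q)
  ... | inj₁ eq = subst (ℚ._≤ r) (sym eq) p-q≤r
  ... | inj₂ eq = subst (ℚ._≤ r) (sym (trans eq
    (solve 2 (λ p q → :- (p :- q) := q :- p) refl p q))) q-p≤r

_-_ : ℝ → ℝ → ℝ
x - y = mkℝ (λ n → seq x n ℚ.- seq y n) isCauchy
  where
  isCauchy : IsCauchy (λ n → seq x n ℚ.- seq y n)
  isCauchy ε 0<ε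
    with cauchy x (ℚ.½ ℚ.* ε) (half-pos ε 0<ε)
       | cauchy y (ℚ.½ ℚ.* ε) (half-pos ε 0<ε)
  ... | M , hx | N , hy = M ℕ.⊔ N , λ m n p q → begin-strict
    ℚ.∣ (seq x m ℚ.- seq y m) ℚ.- (seq x n ℚ.- seq y n) ∣
      ≡⟨ cong ℚ.∣_∣ (sub-swap (seq x m) (seq y m) (seq x n) (seq y n)) ⟩
    ℚ.∣ (seq x m ℚ.- seq x n) ℚ.- (seq y m ℚ.- seq y n) ∣
      ≤⟨ ℚ.∣p-q∣≤∣p∣+∣q∣ (seq x m ℚ.- seq x n) (seq y m ℚ.- seq y n) ⟩
    ℚ.∣ seq x m ℚ.- seq x n ∣ ℚ.+ ℚ.∣ seq y m ℚ.- seq y n ∣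
      <⟨ ℚ.+-mono-< (hx m n (ℕ.m⊔n≤o⇒m≤o M N p) (ℕ.m⊔n≤o⇒m≤o M N q))
                    (hy m n (ℕ.m⊔n≤o⇒n≤o M N p) (ℕ.m⊔n≤o⇒n≤o M N q)) ⟩
    ℚ.½ ℚ.* ε ℚ.+ ℚ.½ ℚ.* ε
      ≡⟨ half+half ε ⟩
    ε ∎
    where open ℚ.≤-Reasoning

∣_∣ : ℝ → ℝ
∣ x ∣ = mkℝ (λ n → ℚ.∣ seq x n ∣) isCauchy
  where
  one-sided : ∀ p q → ℚ.∣ p ∣ ℚ.- ℚ.∣ q ∣ ℚ.≤ ℚ.∣ p ℚ.- q ∣
  one-sided p q = begin
    ℚ.∣ p ∣ ℚ.- ℚ.∣ q ∣
      ≡⟨ cong (λ z → ℚ.∣ z ∣ ℚ.- ℚ.∣ q ∣)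
           (solve 2 (λ p q → p := (p :- q) :+ q) refl p q) ⟩
    ℚ.∣ (p ℚ.- q) ℚ.+ q ∣ ℚ.- ℚ.∣ q ∣
      ≤⟨ ℚ.+-monoˡ-≤ (ℚ.- ℚ.∣ q ∣) (ℚ.∣p+q∣≤∣p∣+∣q∣ (p ℚ.- q) q) ⟩
    ℚ.∣ p ℚ.- q ∣ ℚ.+ ℚ.∣ q ∣ ℚ.- ℚ.∣ q ∣
      ≡⟨ solve 2 (λ u v → u :+ v :- v := u) refl ℚ.∣ p ℚ.- q ∣ ℚ.∣ q ∣ ⟩
    ℚ.∣ p ℚ.- q ∣ ∎
    where open ℚ.≤-Reasoning

  reverse△ : ∀ p q → ℚ.∣ ℚ.∣ p ∣ ℚ.- ℚ.∣ q ∣ ∣ ℚ.≤ ℚ.∣ p ℚ.- q ∣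
  reverse△ p q = ∣∣-bound ℚ.∣ p ∣ ℚ.∣ q ∣ (one-sided p q)
    (subst (ℚ.∣ q ∣ ℚ.- ℚ.∣ p ∣ ℚ.≤_) (∣-∣-swap q p) (one-sided q p))

  isCauchy : IsCauchy (λ n → ℚ.∣ seq x n ∣)
  isCauchy ε 0<ε with cauchy x ε 0<ε
  ... | N , h = N , λ m n p q →
    ℚ.≤-<-trans (reverse△ (seq x m) (seq x n)) (h m n p q)

_·_ : ℚ → ℝ → ℝ
q · x = mkℝ (λ n → q ℚ.* seq x n) isCauchy
  where
  r : ℚ
  r = ℚ.∣ q ∣ ℚ.+ 1ℚ

  instance
    ∣q∣≥0 : ℚ.NonNegative ℚ.∣ q ∣
    ∣q∣≥0 = ℚ.∣-∣-nonNeg q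
    r>0 : ℚ.Positive r
    r>0 = ℚ.nonNeg+pos⇒pos ℚ.∣ q ∣ 1ℚ
    r≢0 : ℚ.NonZero r
    r≢0 = ℚ.pos⇒nonZero r
    1/r>0 : ℚ.Positive (ℚ.1/ r)
    1/r>0 = ℚ.1/pos⇒pos r

  isCauchy : IsCauchy (λ n → q ℚ.* seq x n)
  isCauchy ε 0<ε
    with cauchy x (ℚ.1/ r ℚ.* ε)
           (subst (ℚ._< ℚ.1/ r ℚ.* ε) (ℚ.*-zeroʳ (ℚ.1/ r))
             (ℚ.*-monoʳ-<-pos (ℚ.1/ r) 0<ε))
  ... | N , h = N , λ m n a b → begin-strict
    ℚ.∣ q ℚ.* seq x m ℚ.- q ℚ.* seq x n ∣
      ≡⟨ cong ℚ.∣_∣ (solve 3 (λ q a b → q :* a :- q :* b := q :* (a :- b))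
           refl q (seq x m) (seq x n)) ⟩
    ℚ.∣ q ℚ.* (seq x m ℚ.- seq x n) ∣
      ≡⟨ ℚ.∣p*q∣≡∣p∣*∣q∣ q (seq x m ℚ.- seq x n) ⟩
    ℚ.∣ q ∣ ℚ.* ℚ.∣ seq x m ℚ.- seq x n ∣
      ≤⟨ ℚ.*-monoˡ-≤-nonNeg ℚ.∣ q ∣ (ℚ.<⇒≤ (h m n a b)) ⟩
    ℚ.∣ q ∣ ℚ.* (ℚ.1/ r ℚ.* ε)
      ≡⟨ ℚ.+-identityʳ _ ⟨
    ℚ.∣ q ∣ ℚ.* (ℚ.1/ r ℚ.* ε) ℚ.+ 0ℚ
      <⟨ ℚ.+-monoʳ-< (ℚ.∣ q ∣ ℚ.* (ℚ.1/ r ℚ.* ε))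
           (subst (ℚ._< ℚ.1/ r ℚ.* ε) (ℚ.*-zeroʳ (ℚ.1/ r))
             (ℚ.*-monoʳ-<-pos (ℚ.1/ r) 0<ε)) ⟩
    ℚ.∣ q ∣ ℚ.* (ℚ.1/ r ℚ.* ε) ℚ.+ ℚ.1/ r ℚ.* ε
      ≡⟨ solve 3 (λ a i e → a :* (i :* e) :+ i :* e := ((a :+ con 1ℚ) :* i) :* e)
           refl ℚ.∣ q ∣ (ℚ.1/ r) ε ⟩
    (r ℚ.* ℚ.1/ r) ℚ.* ε
      ≡⟨ cong (ℚ._* ε) (ℚ.*-inverseʳ r) ⟩
    1ℚ ℚ.* ε
      ≡⟨ ℚ.*-identityˡ ε ⟩
    ε ∎
    where open ℚ.≤-Reasoning

_ConvergesTo_ : (ℕ → ℝ) → ℝ → Set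
s ConvergesTo L = ∀ ε → 0ℚ ℚ.< ε →
  ∃[ N ] (∀ n → N ℕ.≤ n → ∣ s n - L ∣ < fromℚ ε)

partialSum : (ℕ → ℚ) → ℕ → ℚ
partialSum a zero    = 0ℚ
partialSum a (suc n) = partialSum a n ℚ.+ a n

HasSum : (ℕ → ℚ) → ℝ → Set
HasSum a L = (λ n → fromℚ (partialSum a n)) ConvergesTo L

-- Indexed from 0, so that the n-th term is 1 / (n + 1)³.
ζ3-term : ℕ → ℚ
ζ3-term n = ℚ._/_ (+ 1) (suc n ℕ.^ 3) {{ℕ.m^n≢0 (suc n) 3}}

private
  Z : ℕ → ℚ
  Z = partialSum ζ3-term

  tail : ℕ → ℚ
  tail n = + 2 ℚ./ suc n

  tail-step-ℕ : ∀ n → let s = suc n in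
    (1 ℕ.* suc s ℕ.+ 2 ℕ.* s ℕ.^ 3) ℕ.* s ℕ.≤ 2 ℕ.* (s ℕ.^ 3 ℕ.* suc s)
  tail-step-ℕ n = subst₂ ℕ._≤_ (sym (lhs n)) (sym (rhs n)) (ℕ.m≤m+n _ _)
    where
    open ℕ-Solver using () renaming
      (solve to solveℕ; _:+_ to _⊕_; _:*_ to _⊗_; _:=_ to _≐_; con to conℕ; _:^_ to _⊛_)
    poly : ℕ → ℕ
    poly n = 2 ℕ.* suc n ℕ.^ 4 ℕ.+ suc n ℕ.^ 2 ℕ.+ suc n
    lhs : ∀ n → (1 ℕ.* suc (suc n) ℕ.+ 2 ℕ.* suc n ℕ.^ 3) ℕ.* suc n ≡ poly n
    lhs = solveℕ 1 (λ n → let s = conℕ 1 ⊕ n in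
      (conℕ 1 ⊗ (conℕ 1 ⊕ s) ⊕ conℕ 2 ⊗ s ⊛ 3) ⊗ s
        ≐ conℕ 2 ⊗ s ⊛ 4 ⊕ s ⊛ 2 ⊕ s) refl
    rhs : ∀ n → 2 ℕ.* (suc n ℕ.^ 3 ℕ.* suc (suc n))
              ≡ poly n ℕ.+ n ℕ.* suc n ℕ.* (2 ℕ.* n ℕ.+ 3)
    rhs = solveℕ 1 (λ n → let s = conℕ 1 ⊕ n in
      conℕ 2 ⊗ (s ⊛ 3 ⊗ (conℕ 1 ⊕ s))
        ≐ (conℕ 2 ⊗ s ⊛ 4 ⊕ s ⊛ 2 ⊕ s) ⊕ n ⊗ s ⊗ (conℕ 2 ⊗ n ⊕ conℕ 3)) refl

  tail-step : ∀ n → ζ3-term n ℚ.+ tail (suc n) ℚ.≤ tail n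
  tail-step n = ℚ.toℚᵘ-cancel-≤ (begin
    ℚ.toℚᵘ (ζ3-term n ℚ.+ tail (suc n))
      ≃⟨ ℚ.toℚᵘ-homo-+ (ζ3-term n) (tail (suc n)) ⟩
    ℚ.toℚᵘ (ζ3-term n) ℚᵘ.+ ℚ.toℚᵘ (tail (suc n))
      ≃⟨ ℚᵘ.+-cong (ℚ.toℚᵘ-fromℚᵘ z) (ℚ.toℚᵘ-fromℚᵘ t′) ⟩
    z ℚᵘ.+ t′
      ≤⟨ ℚᵘ.*≤* (subst₂ ℤ._≤_ (ℤ.pos-* (1 ℕ.* suc (suc n) ℕ.+ 2 ℕ.* suc n ℕ.^ 3) (suc n))
                               (ℤ.pos-* 2 (suc n ℕ.^ 3 ℕ.* suc (suc n)))
           (ℤ.+≤+ (tail-step-ℕ n))) ⟩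
    t
      ≃⟨ ℚ.toℚᵘ-fromℚᵘ t ⟨
    ℚ.toℚᵘ (tail n) ∎)
    where
    open ℚᵘ.≤-Reasoning
    z t t′ : ℚᵘ.ℚᵘ
    z  = ℚᵘ._/_ (+ 1) (suc n ℕ.^ 3) {{ℕ.m^n≢0 (suc n) 3}}
    t  = + 2 ℚᵘ./ suc n
    t′ = + 2 ℚᵘ./ suc (suc n)

  ζ3-term≥0 : ∀ n → 0ℚ ℚ.≤ ζ3-term n
  ζ3-term≥0 n = ℚ.nonNegative⁻¹ _
    {{ℚ.normalize-nonNeg 1 (suc n ℕ.^ 3) {{ℕ.m^n≢0 (suc n) 3}}}}

  Z-mono : ∀ N {n} → N ℕ.≤′ n → Z N ℚ.≤ Z n
  Z-mono N ℕ.≤′-refl = ℚ.≤-refl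
  Z-mono N (ℕ.≤′-step {n} p) = ℚ.≤-trans (Z-mono N p)
    (subst (ℚ._≤ Z (suc n)) (ℚ.+-identityʳ (Z n))
      (ℚ.+-monoʳ-≤ (Z n) (ζ3-term≥0 n)))

  Z+tail-anti : ∀ N {n} → N ℕ.≤′ n → Z n ℚ.+ tail n ℚ.≤ Z N ℚ.+ tail N
  Z+tail-anti N ℕ.≤′-refl = ℚ.≤-refl
  Z+tail-anti N (ℕ.≤′-step {n} p) = begin
    Z n ℚ.+ ζ3-term n ℚ.+ tail (suc n)
      ≡⟨ ℚ.+-assoc (Z n) (ζ3-term n) (tail (suc n)) ⟩
    Z n ℚ.+ (ζ3-term n ℚ.+ tail (suc n))
      ≤⟨ ℚ.+-monoʳ-≤ (Z n) (tail-step n) ⟩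
    Z n ℚ.+ tail n
      ≤⟨ Z+tail-anti N p ⟩
    Z N ℚ.+ tail N ∎
    where open ℚ.≤-Reasoning

  Z-upper : ∀ N {n} → N ℕ.≤ n → Z n ℚ.≤ Z N ℚ.+ tail N
  Z-upper N {n} p = ℚ.≤-trans
    (subst (ℚ._≤ Z n ℚ.+ tail n) (ℚ.+-identityʳ (Z n))
      (ℚ.+-monoʳ-≤ (Z n) (ℚ.nonNegative⁻¹ (tail n) {{ℚ.normalize-nonNeg 2 (suc n)}})))
    (Z+tail-anti N (ℕ.≤⇒≤′ p))

  Z-diff : ∀ N {m n} → N ℕ.≤ m → N ℕ.≤ n → Z m ℚ.- Z n ℚ.≤ tail N
  Z-diff N {m} {n} p q = begin
    Z m ℚ.- Z n
      ≤⟨ ℚ.+-mono-≤ (Z-upper N p) (ℚ.neg-antimono-≤ (Z-mono N (ℕ.≤⇒≤′ q))) ⟩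
    Z N ℚ.+ tail N ℚ.- Z N
      ≡⟨ solve 2 (λ z t → z :+ t :- z := t) refl (Z N) (tail N) ⟩
    tail N ∎
    where open ℚ.≤-Reasoning

  tail<ε : ∀ ε → 0ℚ ℚ.< ε → ∃[ N ] tail N ℚ.< ε
  tail<ε (mkℚ (+ zero)    d c) (ℚ.*<* (ℤ.+<+ ()))
  tail<ε ε@(mkℚ (+ suc p) d c) _ = 2 ℕ.* suc d , ℚ.toℚᵘ-cancel-<
    (ℚᵘ.<-respˡ-≃ (ℚᵘ.≃-sym (ℚ.toℚᵘ-fromℚᵘ t))
      (ℚᵘ.*<* (subst₂ ℤ._<_ (ℤ.pos-* 2 (suc d)) (ℤ.pos-* (suc p) _)
        (ℤ.+<+ (ℕ.m≤m+n _ _)))))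
    where
    t : ℚᵘ.ℚᵘ
    t = + 2 ℚᵘ./ suc (2 ℕ.* suc d)
  tail<ε (mkℚ (ℤ.-[1+ p ]) d c) (ℚ.*<* ())

-- The real represented by the Cauchy sequence of partial sums of Σ 1 / (n + 1)³.
ζ3 : ℝ
ζ3 = mkℝ (partialSum ζ3-term) λ ε 0<ε → let N , tailN<ε = tail<ε ε 0<ε in
  N , λ m n p q → ℚ.≤-<-trans (∣∣-bound (Z m) (Z n) (Z-diff N p q) (Z-diff N q p)) tailN<ε

ζ3-hasSum : HasSum ζ3-term ζ3
ζ3-hasSum ε 0<ε = let N , tailN<ε/2 = tail<ε (ℚ.½ ℚ.* ε) (half-pos ε 0<ε) in
  N , λ n p → ℚ.½ ℚ.* ε , half-pos ε 0<ε , N , λ m q →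
    subst (ℚ.∣ Z n ℚ.- Z m ∣ ℚ.+ ℚ.½ ℚ.* ε ℚ.≤_) (half+half ε)
      (ℚ.+-monoˡ-≤ (ℚ.½ ℚ.* ε)
        (ℚ.≤-trans (∣∣-bound (Z n) (Z m) (Z-diff N p q) (Z-diff N q p))
                   (ℚ.<⇒≤ tailN<ε/2)))

centralBinomial : ℕ → ℕ
centralBinomial k = (2 ℕ.* k) C k

centralBinomial≢0 : ∀ k → ℕ.NonZero (centralBinomial k)
centralBinomial≢0 k = subst ℕ.NonZero (sym (nCk≡n!/k![n-k]! k≤2k))
  (ℕ.>-nonZero (ℕ.m≥n⇒m/n>0 {{_}}
    (ℕ.∣⇒≤ {{ℕ._!≢0 (2 ℕ.* k)}} (k![n∸k]!∣n! k≤2k))))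
  where
  k≤2k : k ℕ.≤ 2 ℕ.* k
  k≤2k = ℕ.m≤m+n k (k ℕ.+ 0)

centralBinomial^≢0 : ∀ k m → ℕ.NonZero (centralBinomial k ℕ.^ m)
centralBinomial^≢0 k m = ℕ.m^n≢0 (centralBinomial k) m {{centralBinomial≢0 k}}

{-# OPTIONS --safe #-}

-- The WZ pair
--   F(n,k) = (-1)ⁿ n!⁶ (n+k)!⁴ (3n+2k+2) / ((2n)! (2n+k+1)!⁴),
--   G(n,k) = (-1)ⁿ n!⁶ (n+k)!⁴ g(n+1, 2n+k+2) / ((2n+2)! (2n+k+2)!⁴)
-- with the polynomial g below satisfies F(n+1,k) - F(n,k) = G(n,k+1) - G(n,k), and F(0,k) = 2/(k+1)³.  Summing over
-- the square 0 ≤ n, k < N and using F(N,k) = O(1/N²) and G(n,N) = O(1/N²) gives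
-- 2ζ(3) = Σ G(n,0), the series of Amdeberhan and Zeilberger.  Five times the summand of the
-- theorem is -32 G(k,0) + D(k+1) - D(k), where D(k) = (-1)ᵏ q(k) / C(2k,k)⁵ tends to 0, D(0) = -231168,
-- and q has degree 4.

module Submission where

open import Data.Integer.Base as ℤ using (ℤ; +_; -1ℤ)
import Data.Integer.Properties as ℤ
open import Data.Nat.Base as ℕ using (ℕ; zero; suc; _!)
open import Data.Nat.Combinatorics using (nCk≡n!/k![n-k]!; k![n∸k]!∣n!)
open import Data.Nat.DivMod using (m/n*n≡m)
import Data.Nat.Properties as ℕ
open import Data.Nat.Solver renaming (module +-*-Solver to ℕ-Solver)
open import Data.Product.Base using (_×_; _,_; proj₁; proj₂; ∃-syntax)
open import Data.Rational.Base as ℚ using (ℚ; 0ℚ; 1ℚ; _+_; _*_; -_; _≤_)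
import Data.Rational.Properties as ℚ
open import Data.Rational.Solver using (module +-*-Solver)
import Data.Rational.Unnormalised.Base as ℚᵘ
import Data.Rational.Unnormalised.Properties as ℚᵘ
open import Relation.Binary.PropositionalEquality
open import Defs

open import Algebra.Definitions.RawSemiring ℚ.+-*-rawSemiring using (_^_)
open +-*-Solver using (solve; _:+_; _:*_; :-_; _:=_; con; _:-_; Polynomial)

-- Summing over a square keeps the argument inside ℚ: for every n the result is an exact identity
-- between finite sums, so no infinite sum over k is formed and no limits are exchanged. The price
-- is that each far edge of the square carries n terms; a bound of order 1/n² for a single term is
-- therefore what is needed, and it leaves an error of order 1/n. Crude inequalities suffice for it,
-- essentially m! n! ≤ (m+n)! and n!² (n+1) ≤ (2n)!. Both the WZ equation and the relation between
-- the two series become polynomial identities once a common product of factorials is split off.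
-- Division never enters them: reciprocals of factorials are atoms `inv! m`, and passing to the
-- largest index that occurs turns every shift into a polynomial factor, which the ring solver can
-- handle.

-- The embeddings of ℤ and ℕ into ℚ

private
  -- Reduction to lowest terms does not compute on variables, so the homomorphism laws below are
  -- checked on unnormalised fractions with denominator 1.
  toℚᵘ-fromℤ : ∀ i → ℚ.toℚᵘ (fromℤ i) ℚᵘ.≃ ℚᵘ.mkℚᵘ i 0
  toℚᵘ-fromℤ i = ℚ.toℚᵘ-fromℚᵘ (ℚᵘ.mkℚᵘ i 0)

fromℤ-+ : ∀ i j → fromℤ (i ℤ.+ j) ≡ fromℤ i + fromℤ j
fromℤ-+ i j = ℚ.toℚᵘ-injective (begin
  ℚ.toℚᵘ (fromℤ (i ℤ.+ j))                ≈⟨ toℚᵘ-fromℤ (i ℤ.+ j) ⟩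
  ℚᵘ.mkℚᵘ (i ℤ.+ j) 0                     ≡⟨ cong₂ (λ u v → ℚᵘ.mkℚᵘ (u ℤ.+ v) 0)
                                               (ℤ.*-identityʳ i) (ℤ.*-identityʳ j) ⟨
  ℚᵘ.mkℚᵘ i 0 ℚᵘ.+ ℚᵘ.mkℚᵘ j 0            ≈⟨ ℚᵘ.+-cong (toℚᵘ-fromℤ i) (toℚᵘ-fromℤ j) ⟨
  ℚ.toℚᵘ (fromℤ i) ℚᵘ.+ ℚ.toℚᵘ (fromℤ j)  ≈⟨ ℚ.toℚᵘ-homo-+ (fromℤ i) (fromℤ j) ⟨
  ℚ.toℚᵘ (fromℤ i + fromℤ j)              ∎)
  where open import Relation.Binary.Reasoning.Setoid ℚᵘ.≃-setoid

fromℤ-* : ∀ i j → fromℤ (i ℤ.* j) ≡ fromℤ i * fromℤ j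
fromℤ-* i j = ℚ.toℚᵘ-injective (begin
  ℚ.toℚᵘ (fromℤ (i ℤ.* j))                ≈⟨ toℚᵘ-fromℤ (i ℤ.* j) ⟩
  ℚᵘ.mkℚᵘ i 0 ℚᵘ.* ℚᵘ.mkℚᵘ j 0            ≈⟨ ℚᵘ.*-cong (toℚᵘ-fromℤ i) (toℚᵘ-fromℤ j) ⟨
  ℚ.toℚᵘ (fromℤ i) ℚᵘ.* ℚ.toℚᵘ (fromℤ j)  ≈⟨ ℚ.toℚᵘ-homo-* (fromℤ i) (fromℤ j) ⟨
  ℚ.toℚᵘ (fromℤ i * fromℤ j)              ∎)
  where open import Relation.Binary.Reasoning.Setoid ℚᵘ.≃-setoid

fromℤ-neg : ∀ i → fromℤ (ℤ.- i) ≡ - fromℤ i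
fromℤ-neg i = ℚ.toℚᵘ-injective (begin
  ℚ.toℚᵘ (fromℤ (ℤ.- i))                ≈⟨ toℚᵘ-fromℤ (ℤ.- i) ⟩
  ℚᵘ.- ℚᵘ.mkℚᵘ i 0                      ≈⟨ ℚᵘ.-‿cong (toℚᵘ-fromℤ i) ⟨
  ℚᵘ.- ℚ.toℚᵘ (fromℤ i)                 ≈⟨ ℚ.toℚᵘ-homo‿- (fromℤ i) ⟨
  ℚ.toℚᵘ (- fromℤ i)                    ∎)
  where open import Relation.Binary.Reasoning.Setoid ℚᵘ.≃-setoid

fromℤ-- : ∀ i j → fromℤ (i ℤ.- j) ≡ fromℤ i ℚ.- fromℤ j
fromℤ-- i j = trans (fromℤ-+ i (ℤ.- j)) (cong (λ x → fromℤ i + x) (fromℤ-neg j))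

/-*-cancel : ∀ i d .{{_ : ℕ.NonZero d}} → (i ℚ./ d) * fromℤ (+ d) ≡ fromℤ i
/-*-cancel i d@(suc _) = ℚ.toℚᵘ-injective (begin
  ℚ.toℚᵘ ((i ℚ./ d) * fromℤ (+ d))              ≈⟨ ℚ.toℚᵘ-homo-* (i ℚ./ d) (fromℤ (+ d)) ⟩
  ℚ.toℚᵘ (i ℚ./ d) ℚᵘ.* ℚ.toℚᵘ (fromℤ (+ d))    ≈⟨ ℚᵘ.*-cong (ℚ.toℚᵘ-fromℚᵘ (i ℚᵘ./ d)) (toℚᵘ-fromℤ (+ d)) ⟩
  (i ℚᵘ./ d) ℚᵘ.* ℚᵘ.mkℚᵘ (+ d) 0               ≈⟨ ℚᵘ.*≡* (ℤ.*-assoc i (+ d) (+ 1)) ⟩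
  ℚᵘ.mkℚᵘ i 0                                   ≈⟨ toℚᵘ-fromℤ i ⟨
  ℚ.toℚᵘ (fromℤ i)                              ∎)
  where open import Relation.Binary.Reasoning.Setoid ℚᵘ.≃-setoid

fromℤ-mono-≤ : ∀ {i j} → i ℤ.≤ j → fromℤ i ≤ fromℤ j
fromℤ-mono-≤ {i} {j} i≤j = ℚ.toℚᵘ-cancel-≤ (begin
  ℚ.toℚᵘ (fromℤ i)  ≃⟨ toℚᵘ-fromℤ i ⟩
  ℚᵘ.mkℚᵘ i 0       ≤⟨ ℚᵘ.*≤* (ℤ.*-monoʳ-≤-nonNeg (+ 1) i≤j) ⟩
  ℚᵘ.mkℚᵘ j 0       ≃⟨ toℚᵘ-fromℤ j ⟨
  ℚ.toℚᵘ (fromℤ j)  ∎)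
  where open ℚᵘ.≤-Reasoning

-- Opaque, since otherwise unification unfolds the reduction to lowest terms.
opaque
  ι : ℕ → ℚ
  ι n = fromℤ (+ n)

  ι-def : ∀ n → ι n ≡ fromℤ (+ n)
  ι-def n = refl

  ι-+ : ∀ m n → ι (m ℕ.+ n) ≡ ι m + ι n
  ι-+ m n = fromℤ-+ (+ m) (+ n)

  ι-* : ∀ m n → ι (m ℕ.* n) ≡ ι m * ι n
  ι-* m n = trans (cong fromℤ (ℤ.pos-* m n)) (fromℤ-* (+ m) (+ n))

  ι-mono-≤ : ∀ {m n} → m ℕ.≤ n → ι m ≤ ι n
  ι-mono-≤ m≤n = fromℤ-mono-≤ (ℤ.+≤+ m≤n)

  ι1≡1 : ι 1 ≡ 1ℚ
  ι1≡1 = refl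

  ι0≡0 : ι 0 ≡ 0ℚ
  ι0≡0 = refl

ι-suc : ∀ n → ι (suc n) ≡ ι n + 1ℚ
ι-suc n = trans (ι-+ 1 n) (trans (ℚ.+-comm (ι 1) (ι n)) (cong (λ x → ι n + x) ι1≡1))

0≤ι : ∀ n → 0ℚ ≤ ι n
0≤ι n = subst (_≤ ι n) ι0≡0 (ι-mono-≤ ℕ.z≤n)

-- Inequalities

infix 4 _∈[0,_]
-- Bounds travel together with nonnegativity, because multiplying two upper bounds needs both.
_∈[0,_] : ℚ → ℚ → Set
x ∈[0, b ] = 0ℚ ≤ x × x ≤ b

0≤* : ∀ {x y} → 0ℚ ≤ x → 0ℚ ≤ y → 0ℚ ≤ x * y
0≤* {x} {y} 0≤x 0≤y = subst (_≤ x * y) (ℚ.*-zeroʳ x)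
  (ℚ.*-monoˡ-≤-nonNeg x {{ℚ.nonNegative 0≤x}} 0≤y)

∈-* : ∀ {x y b c} → x ∈[0, b ] → y ∈[0, c ] → x * y ∈[0, b * c ]
∈-* {x} {y} {b} {c} (0≤x , x≤b) (0≤y , y≤c) = 0≤* 0≤x 0≤y ,
  ℚ.≤-trans (ℚ.*-monoʳ-≤-nonNeg y {{ℚ.nonNegative 0≤y}} x≤b)
            (ℚ.*-monoˡ-≤-nonNeg b {{ℚ.nonNegative (ℚ.≤-trans 0≤x x≤b)}} y≤c)

∈-+ : ∀ {x y b c} → x ∈[0, b ] → y ∈[0, c ] → x + y ∈[0, b + c ]
∈-+ (0≤x , x≤b) (0≤y , y≤c) = ℚ.+-mono-≤ 0≤x 0≤y , ℚ.+-mono-≤ x≤b y≤c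

∈-trans : ∀ {x b c} → x ∈[0, b ] → b ≤ c → x ∈[0, c ]
∈-trans (0≤x , x≤b) b≤c = 0≤x , ℚ.≤-trans x≤b b≤c

∈-refl : ∀ {x} → 0ℚ ≤ x → x ∈[0, x ]
∈-refl 0≤x = 0≤x , ℚ.≤-refl

∣x-y∣≤ : ∀ {x y b c} → x ∈[0, b ] → y ∈[0, c ] → ℚ.∣ x ℚ.- y ∣ ≤ b + c
∣x-y∣≤ {x} {y} {b} {c} (0≤x , x≤b) (0≤y , y≤c) = begin
  ℚ.∣ x ℚ.- y ∣         ≤⟨ ℚ.∣p-q∣≤∣p∣+∣q∣ x y ⟩
  ℚ.∣ x ∣ + ℚ.∣ y ∣     ≡⟨ cong₂ _+_ (ℚ.0≤p⇒∣p∣≡p 0≤x) (ℚ.0≤p⇒∣p∣≡p 0≤y) ⟩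
  x + y                 ≤⟨ ℚ.+-mono-≤ x≤b y≤c ⟩
  b + c                 ∎
  where open ℚ.≤-Reasoning

-- Signs and reciprocals of factorials

opaque
  sign : ℕ → ℚ
  sign n = fromℤ (-1ℤ ℤ.^ n)

  sign-def : ∀ n → sign n ≡ fromℤ (-1ℤ ℤ.^ n)
  sign-def n = refl

  sign-suc : ∀ n → sign (suc n) ≡ - sign n
  sign-suc n = trans (fromℤ-* -1ℤ (-1ℤ ℤ.^ n))
    (solve 1 (λ s → con (- 1ℚ) :* s := :- s) refl (sign n))

  ∣sign∣ : ∀ n → ℚ.∣ sign n ∣ ≡ 1ℚ
  ∣sign∣ zero    = refl
  ∣sign∣ (suc n) = trans (cong ℚ.∣_∣ (sign-suc n)) (trans (ℚ.∣-p∣≡∣p∣ (sign n)) (∣sign∣ n))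

∣sign*x∣ : ∀ n x → ℚ.∣ sign n * x ∣ ≡ ℚ.∣ x ∣
∣sign*x∣ n x = trans (ℚ.∣p*q∣≡∣p∣*∣q∣ (sign n) x)
  (trans (cong (_* ℚ.∣ x ∣) (∣sign∣ n)) (ℚ.*-identityˡ ℚ.∣ x ∣))

fac : ℕ → ℚ
fac m = ι (m !)

fac-suc : ∀ m → fac (suc m) ≡ ι (suc m) * fac m
fac-suc m = ι-* (suc m) (m !)

opaque
  unfolding ι

  recip : ∀ d .{{_ : ℕ.NonZero d}} → ℚ
  recip d = + 1 ℚ./ d

  recip-inverseˡ : ∀ d .{{_ : ℕ.NonZero d}} → recip d * ι d ≡ 1ℚ
  recip-inverseˡ d = /-*-cancel (+ 1) d

  0≤recip : ∀ d .{{_ : ℕ.NonZero d}} → 0ℚ ≤ recip d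
  0≤recip d = ℚ.nonNegative⁻¹ _ {{ℚ.normalize-nonNeg 1 d}}

inv! : ℕ → ℚ
inv! m = recip (m !) {{m ℕ.!≢0}}

inv!-inverseˡ : ∀ m → inv! m * fac m ≡ 1ℚ
inv!-inverseˡ m = recip-inverseˡ (m !) {{m ℕ.!≢0}}

0≤inv! : ∀ m → 0ℚ ≤ inv! m
0≤inv! m = 0≤recip (m !) {{m ℕ.!≢0}}

-- Oriented towards the larger index, so that all reciprocals in an identity become polynomial
-- multiples of the one with the largest index.
inv!-suc : ∀ m → inv! m ≡ inv! (suc m) * ι (suc m)
inv!-suc m = begin
  inv! m                                        ≡⟨ ℚ.*-identityˡ (inv! m) ⟨
  1ℚ * inv! m                                   ≡⟨ cong (_* inv! m) (inv!-inverseˡ (suc m)) ⟨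
  inv! (suc m) * fac (suc m) * inv! m           ≡⟨ cong (λ z → inv! (suc m) * z * inv! m) (fac-suc m) ⟩
  inv! (suc m) * (ι (suc m) * fac m) * inv! m   ≡⟨ solve 4 (λ i s f j → i :* (s :* f) :* j := i :* s :* (j :* f)) refl
                                                     (inv! (suc m)) (ι (suc m)) (fac m) (inv! m) ⟩
  inv! (suc m) * ι (suc m) * (inv! m * fac m)   ≡⟨ cong (inv! (suc m) * ι (suc m) *_) (inv!-inverseˡ m) ⟩
  inv! (suc m) * ι (suc m) * 1ℚ                 ≡⟨ ℚ.*-identityʳ _ ⟩
  inv! (suc m) * ι (suc m)                      ∎
  where open ≡-Reasoning

-- Doubled indices in factorials

2ℚ : ℚ
2ℚ = fromℤ (+ 2)

-- Recursive, so that `double (suc n)` unfolds to two successors and the index of `F (suc n) k`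
-- agrees with that of `F n k` shifted by two, without transport.
double : ℕ → ℕ
double zero    = zero
double (suc n) = suc (suc (double n))

double≡2* : ∀ n → double n ≡ 2 ℕ.* n
double≡2* zero    = refl
double≡2* (suc n) = cong suc (trans (cong suc (double≡2* n)) (sym (ℕ.+-suc n (n ℕ.+ 0))))

ι-double : ∀ n → ι (double n) ≡ 2ℚ * ι n
ι-double n = trans (cong ι (double≡2* n)) (trans (ι-* 2 n) (cong (_* ι n) (ι-def 2)))

ι-suc² : ∀ m → ι (suc (suc m)) ≡ ι m + 1ℚ + 1ℚ
ι-suc² m = trans (ι-suc (suc m)) (cong (_+ 1ℚ) (ι-suc m))

ι-suc-double : ∀ n → ι (suc (double n)) ≡ 2ℚ * ι (suc n) ℚ.- 1ℚ
ι-suc-double n = begin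
  ι (suc (double n))         ≡⟨ ι-suc (double n) ⟩
  ι (double n) + 1ℚ          ≡⟨ cong (_+ 1ℚ) (ι-double n) ⟩
  2ℚ * ι n + 1ℚ              ≡⟨ solve 1 (λ x → con 2ℚ :* x :+ con 1ℚ := con 2ℚ :* (x :+ con 1ℚ) :- con 1ℚ) refl (ι n) ⟩
  2ℚ * (ι n + 1ℚ) ℚ.- 1ℚ     ≡⟨ cong (λ x → 2ℚ * x ℚ.- 1ℚ) (ι-suc n) ⟨
  2ℚ * ι (suc n) ℚ.- 1ℚ      ∎
  where open ≡-Reasoning

inv!-double : ∀ n → inv! (double n) ≡
  (2ℚ * ι (suc n) ℚ.- 1ℚ) * (2ℚ * ι (suc n)) * inv! (double (suc n))
inv!-double n = begin
  inv! (double n)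
    ≡⟨ inv!-suc (double n) ⟩
  inv! (suc (double n)) * ι (suc (double n))
    ≡⟨ cong₂ _*_ (inv!-suc (suc (double n))) (ι-suc-double n) ⟩
  i * ι (double (suc n)) * (2ℚ * a ℚ.- 1ℚ)
    ≡⟨ cong (λ x → i * x * (2ℚ * a ℚ.- 1ℚ)) (ι-double (suc n)) ⟩
  i * (2ℚ * a) * (2ℚ * a ℚ.- 1ℚ)
    ≡⟨ solve 3 (λ i x y → i :* x :* y := y :* x :* i) refl i (2ℚ * a) (2ℚ * a ℚ.- 1ℚ) ⟩
  (2ℚ * a ℚ.- 1ℚ) * (2ℚ * a) * i ∎
  where
  open ≡-Reasoning
  a = ι (suc n)
  i = inv! (double (suc n))

-- The growth factor n+k+1 of (n+k)!, written as s - a in the variables of the WZ pair.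
ι-suc-+ : ∀ n k → ι (suc (n ℕ.+ k)) ≡ ι (suc (suc (double n ℕ.+ k))) ℚ.- ι (suc n)
ι-suc-+ n k = begin
  ι (suc (n ℕ.+ k))
    ≡⟨ trans (ι-suc (n ℕ.+ k)) (cong (_+ 1ℚ) (ι-+ n k)) ⟩
  ι n + ι k + 1ℚ
    ≡⟨ solve 2 (λ x y → x :+ y :+ con 1ℚ
         := con 2ℚ :* x :+ y :+ con 1ℚ :+ con 1ℚ :- (x :+ con 1ℚ)) refl (ι n) (ι k) ⟩
  2ℚ * ι n + ι k + 1ℚ + 1ℚ ℚ.- (ι n + 1ℚ)
    ≡⟨ cong₂ (λ x y → x + 1ℚ + 1ℚ ℚ.- y)
         (trans (ι-+ (double n) k) (cong (_+ ι k) (ι-double n))) (ι-suc n) ⟨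
  ι (double n ℕ.+ k) + 1ℚ + 1ℚ ℚ.- ι (suc n)
    ≡⟨ cong (ℚ._- ι (suc n)) (ι-suc² (double n ℕ.+ k)) ⟨
  ι (suc (suc (double n ℕ.+ k))) ℚ.- ι (suc n) ∎
  where open ≡-Reasoning

-- The WZ pair

infix 8 _⁴
_⁴ : ℚ → ℚ
x ⁴ = (x * x) * (x * x)

-- F and G are a weight times a polynomial in a = n+1 and s = 2n+k+2, the variables in which
-- g is sparse; its positive and negative parts are kept apart for the estimate of ∣G∣.
weight : ℚ → ℚ → ℚ → ℚ → ℚ
weight p r i j = (p * p) * p ⁴ * r ⁴ * i * j ⁴

f : ℚ → ℚ → ℚ
f a s = 2ℚ * s ℚ.- a ℚ.- 1ℚ

g⁺ g⁻ g : ℚ → ℚ → ℚ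
g⁺ a s = a * (s ⁴ * (2ℚ * ((s ℚ.- 1ℚ) * (s ℚ.- 1ℚ)) + 2ℚ * (a * (s ℚ.- 1ℚ)) + a * a) + a * a * a ⁴)
g⁻ a s = a * (2ℚ * (a * a ⁴ * s))
g a s = g⁺ a s ℚ.- g⁻ a s

F G : ℕ → ℕ → ℚ
F n k = sign n *
  (weight (fac n) (fac (n ℕ.+ k)) (inv! (double n)) (inv! (suc (double n ℕ.+ k)))
    * f (ι (suc n)) (ι (suc (suc (double n ℕ.+ k)))))
G n k = sign n *
  (weight (fac n) (fac (n ℕ.+ k)) (inv! (double (suc n))) (inv! (suc (suc (double n ℕ.+ k))))
    * g (ι (suc n)) (ι (suc (suc (double n ℕ.+ k)))))

private
  infix 9 _:⁴
  _:⁴ : ∀ {m} → Polynomial m → Polynomial m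
  x :⁴ = (x :* x) :* (x :* x)

  :weight : ∀ {m} → Polynomial m → Polynomial m → Polynomial m → Polynomial m → Polynomial m
  :weight p r i j = (p :* p) :* p :⁴ :* r :⁴ :* i :* j :⁴

  :1 :2 : ∀ {m} → Polynomial m
  :1 = con 1ℚ
  :2 = con 2ℚ

  :f :g : ∀ {m} → Polynomial m → Polynomial m → Polynomial m
  :f a s = :2 :* s :- a :- :1
  :g a s = a :* (s :⁴ :* (:2 :* ((s :- :1) :* (s :- :1)) :+ :2 :* (a :* (s :- :1)) :+ a :* a) :+ a :* a :* a :⁴)
    :- a :* (:2 :* (a :* a :⁴ :* s))

weight-* : ∀ p r i j p′ r′ i′ j′ →
  weight (p * p′) (r * r′) (i * i′) (j * j′) ≡ weight p r i j * weight p′ r′ i′ j′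
weight-* = solve 8 (λ p r i j p′ r′ i′ j′ →
  :weight (p :* p′) (r :* r′) (i :* i′) (j :* j′) := :weight p r i j :* :weight p′ r′ i′ j′) refl

-- The WZ equation divided by (-1)ⁿ n!⁶ (n+k)!⁴ / ((2n+2)! (2n+k+3)!⁴), the part common to all four
-- terms. What remains of each weight records the shifts: n! gains a, (n+k)! gains s - a, 1/(2n)!
-- contributes (2a-1)(2a), and 1/(2n+k+1)! contributes s(s+1).
certificate : ∀ a s →
  - (weight a (s ℚ.- a) 1ℚ 1ℚ * f (a + 1ℚ) (s + 2ℚ))
    ℚ.- weight 1ℚ 1ℚ ((2ℚ * a ℚ.- 1ℚ) * (2ℚ * a)) (s * (s + 1ℚ)) * f a s
  ≡ weight 1ℚ (s ℚ.- a) 1ℚ 1ℚ * g a (s + 1ℚ) ℚ.- weight 1ℚ 1ℚ 1ℚ (s + 1ℚ) * g a s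
certificate = solve 2 (λ a s →
  :- (:weight a (s :- a) :1 :1 :* :f (a :+ :1) (s :+ :2))
    :- :weight :1 :1 ((:2 :* a :- :1) :* (:2 :* a)) (s :* (s :+ :1)) :* :f a s
  := :weight :1 (s :- a) :1 :1 :* :g a (s :+ :1) :- :weight :1 :1 :1 (s :+ :1) :* :g a s) refl

telescope : ∀ n k → F (suc n) k ℚ.- F n k ≡ G n (suc k) ℚ.- G n k
telescope n k = begin
  F (suc n) k ℚ.- F n k
    ≡⟨ cong₂ ℚ._-_ F′ F₀ ⟩
  (- σ) * (u₁ * w * f (a + 1ℚ) (s + 2ℚ)) ℚ.- σ * (u₂ * w * f a s)
    ≡⟨ solve 6 (λ σ w u u′ v v′ →
         (:- σ) :* (u :* w :* u′) :- σ :* (v :* w :* v′) := σ :* w :* (:- (u :* u′) :- v :* v′))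
         refl σ w u₁ (f (a + 1ℚ) (s + 2ℚ)) u₂ (f a s) ⟩
  σ * w * (- (u₁ * f (a + 1ℚ) (s + 2ℚ)) ℚ.- u₂ * f a s)
    ≡⟨ cong (σ * w *_) (certificate a s) ⟩
  σ * w * (u₃ * g a (s + 1ℚ) ℚ.- u₄ * g a s)
    ≡⟨ solve 6 (λ σ w u u′ v v′ →
         σ :* w :* (u :* u′ :- v :* v′) := σ :* (u :* w :* u′) :- σ :* (v :* w :* v′))
         refl σ w u₃ (g a (s + 1ℚ)) u₄ (g a s) ⟩
  σ * (u₃ * w * g a (s + 1ℚ)) ℚ.- σ * (u₄ * w * g a s)
    ≡⟨ cong₂ ℚ._-_ G′ G₀ ⟨
  G n (suc k) ℚ.- G n k ∎
  where
  open ≡-Reasoning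
  e = double n ℕ.+ k
  σ = sign n
  a = ι (suc n)
  s = ι (suc (suc e))
  p = fac n
  r = fac (n ℕ.+ k)
  i = inv! (double (suc n))
  j = inv! (suc (suc (suc e)))
  w = weight p r i j
  u₁ = weight a (s ℚ.- a) 1ℚ 1ℚ
  u₂ = weight 1ℚ 1ℚ ((2ℚ * a ℚ.- 1ℚ) * (2ℚ * a)) (s * (s + 1ℚ))
  u₃ = weight 1ℚ (s ℚ.- a) 1ℚ 1ℚ
  u₄ = weight 1ℚ 1ℚ 1ℚ (s + 1ℚ)

  scaled : ∀ {p′ r′ i′ j′ x} b c d h →
    p′ ≡ b * p → r′ ≡ c * r → i′ ≡ d * i → j′ ≡ h * j →
    weight p′ r′ i′ j′ * x ≡ weight b c d h * w * x
  scaled b c d h refl refl refl refl = cong (_* _) (weight-* b c d h p r i j)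

  unscaled : ∀ x → x ≡ 1ℚ * x
  unscaled x = sym (ℚ.*-identityˡ x)

  s+1 : ι (suc (suc (suc e))) ≡ s + 1ℚ
  s+1 = ι-suc (suc (suc e))

  r-step : fac (suc (n ℕ.+ k)) ≡ (s ℚ.- a) * r
  r-step = trans (fac-suc (n ℕ.+ k)) (cong (_* r) (ι-suc-+ n k))

  j-step : inv! (suc (suc e)) ≡ (s + 1ℚ) * j
  j-step = trans (inv!-suc (suc (suc e))) (trans (cong (j *_) s+1) (ℚ.*-comm j (s + 1ℚ)))

  j-step₂ : inv! (suc e) ≡ s * (s + 1ℚ) * j
  j-step₂ = trans (inv!-suc (suc e)) (trans (cong (_* s) j-step)
    (solve 2 (λ s j → (s :+ :1) :* j :* s := s :* (s :+ :1) :* j) refl s j))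

  F₀ : F n k ≡ σ * (u₂ * w * f a s)
  F₀ = cong (σ *_) (scaled 1ℚ 1ℚ ((2ℚ * a ℚ.- 1ℚ) * (2ℚ * a)) (s * (s + 1ℚ)) (unscaled p) (unscaled r) (inv!-double n) j-step₂)

  F′ : F (suc n) k ≡ (- σ) * (u₁ * w * f (a + 1ℚ) (s + 2ℚ))
  F′ = cong₂ _*_ (sign-suc n) (trans
    (scaled a (s ℚ.- a) 1ℚ 1ℚ (fac-suc n) r-step (unscaled i) (unscaled j))
    (cong₂ (λ x y → u₁ * w * f x y) (ι-suc (suc n))
      (trans (ι-suc² (suc (suc e))) (ℚ.+-assoc s 1ℚ 1ℚ))))

  G₀ : G n k ≡ σ * (u₄ * w * g a s)
  G₀ = cong (σ *_) (scaled 1ℚ 1ℚ 1ℚ (s + 1ℚ) (unscaled p) (unscaled r) (unscaled i) j-step)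

  G′ : G n (suc k) ≡ σ * (u₃ * w * g a (s + 1ℚ))
  G′ = begin
    G n (suc k)
      ≡⟨ cong₂ (λ m m′ → σ * (weight p (fac m) i (inv! (suc (suc m′))) * g a (ι (suc (suc m′)))))
           (ℕ.+-suc n k) (ℕ.+-suc (double n) k) ⟩
    σ * (weight p (fac (suc (n ℕ.+ k))) i j * g a (ι (suc (suc (suc e)))))
      ≡⟨ cong (σ *_) (scaled 1ℚ (s ℚ.- a) 1ℚ 1ℚ (unscaled p) r-step (unscaled i) (unscaled j)) ⟩
    σ * (u₃ * w * g a (ι (suc (suc (suc e)))))
      ≡⟨ cong (λ x → σ * (u₃ * w * g a x)) s+1 ⟩
    σ * (u₃ * w * g a (s + 1ℚ)) ∎

-- Bounds for the WZ pair

m!*n!≤[m+n]! : ∀ m n → m ! ℕ.* n ! ℕ.≤ (m ℕ.+ n) !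
m!*n!≤[m+n]! zero    n = ℕ.≤-reflexive (ℕ.*-identityˡ (n !))
m!*n!≤[m+n]! (suc m) n = begin
  suc m ℕ.* m ! ℕ.* n !              ≡⟨ ℕ.*-assoc (suc m) (m !) (n !) ⟩
  suc m ℕ.* (m ! ℕ.* n !)            ≤⟨ ℕ.*-mono-≤ (ℕ.s≤s (ℕ.m≤m+n m n)) (m!*n!≤[m+n]! m n) ⟩
  suc (m ℕ.+ n) ℕ.* (m ℕ.+ n) !      ∎
  where open ℕ.≤-Reasoning

double≡+ : ∀ n → double n ≡ n ℕ.+ n
double≡+ n = trans (double≡2* n) (cong (n ℕ.+_) (ℕ.+-identityʳ n))

n!*[n+k]!≤ : ∀ n k → n ! ℕ.* (n ℕ.+ k) ! ℕ.≤ (double n ℕ.+ k) !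
n!*[n+k]!≤ n k = subst (λ m → n ! ℕ.* (n ℕ.+ k) ! ℕ.≤ m !)
  (trans (sym (ℕ.+-assoc n n k)) (cong (ℕ._+ k) (sym (double≡+ n)))) (m!*n!≤[m+n]! n (n ℕ.+ k))

n≤double : ∀ n → n ℕ.≤ double n
n≤double n = subst (n ℕ.≤_) (sym (double≡+ n)) (ℕ.m≤m+n n n)

-- Equivalent to C(2n,n) ≥ n+1. In the step, (2n+2)(2n+1) dominates (n+2)(n+1).
n!*n!*[1+n]≤ : ∀ n → n ! ℕ.* n ! ℕ.* suc n ℕ.≤ double n !
n!*n!*[1+n]≤ zero    = ℕ.≤-refl
n!*n!*[1+n]≤ (suc n) = begin
  suc n ! ℕ.* suc n ! ℕ.* suc (suc n)
    ≡⟨ rearrange (suc n) (n !) (suc (suc n)) ⟩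
  suc (suc n) ℕ.* (suc n ℕ.* (n ! ℕ.* n ! ℕ.* suc n))
    ≤⟨ ℕ.*-mono-≤ (ℕ.s≤s (ℕ.s≤s (n≤double n)))
         (ℕ.*-mono-≤ (ℕ.s≤s (n≤double n)) (n!*n!*[1+n]≤ n)) ⟩
  double (suc n) ! ∎
  where
  open ℕ.≤-Reasoning
  rearrange : ∀ a p b → a ℕ.* p ℕ.* (a ℕ.* p) ℕ.* b ≡ b ℕ.* (a ℕ.* (p ℕ.* p ℕ.* a))
  rearrange = ℕ-Solver.solve 3 (λ a p b →
    a ℕ-Solver.:* p ℕ-Solver.:* (a ℕ-Solver.:* p) ℕ-Solver.:* b
      ℕ-Solver.:= b ℕ-Solver.:* (a ℕ-Solver.:* (p ℕ-Solver.:* p ℕ-Solver.:* a))) refl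

0≤fac : ∀ n → 0ℚ ≤ fac n
0≤fac n = 0≤ι (n !)

ι*inv!∈[0,1] : ∀ m M → m ℕ.≤ M ! → ι m * inv! M ∈[0, 1ℚ ]
ι*inv!∈[0,1] m M m≤M! = 0≤* (0≤ι m) (0≤inv! M) , (begin
  ι m * inv! M      ≤⟨ ℚ.*-monoʳ-≤-nonNeg (inv! M) {{ℚ.nonNegative (0≤inv! M)}} (ι-mono-≤ m≤M!) ⟩
  fac M * inv! M    ≡⟨ ℚ.*-comm (fac M) (inv! M) ⟩
  inv! M * fac M    ≡⟨ inv!-inverseˡ M ⟩
  1ℚ                ∎)
  where open ℚ.≤-Reasoning

≤recip : ∀ {x m} M → 0ℚ ≤ x → x * ι m ≤ 1ℚ → suc M ℕ.≤ m → x ∈[0, recip (suc M) ]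
≤recip {x} {m} M 0≤x xm≤1 M<m = 0≤x , (begin
  x                                 ≡⟨ ℚ.*-identityʳ x ⟨
  x * 1ℚ                            ≡⟨ cong (x *_) (recip-inverseˡ (suc M)) ⟨
  x * (recip (suc M) * ι (suc M))   ≡⟨ solve 3 (λ x c n → x :* (c :* n) := (x :* n) :* c) refl x (recip (suc M)) (ι (suc M)) ⟩
  x * ι (suc M) * recip (suc M)     ≤⟨ ℚ.*-monoʳ-≤-nonNeg (recip (suc M)) {{ℚ.nonNegative (0≤recip (suc M))}}
                                         (ℚ.≤-trans (ℚ.*-monoˡ-≤-nonNeg x {{ℚ.nonNegative 0≤x}} (ι-mono-≤ M<m)) xm≤1) ⟩
  1ℚ * recip (suc M)                ≡⟨ ℚ.*-identityˡ (recip (suc M)) ⟩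
  recip (suc M)                     ∎)
  where open ℚ.≤-Reasoning

recip∈[0,1] : ∀ M → recip (suc M) ∈[0, 1ℚ ]
recip∈[0,1] M = 0≤recip (suc M) , (begin
  recip (suc M)                 ≡⟨ ℚ.*-identityʳ (recip (suc M)) ⟨
  recip (suc M) * 1ℚ            ≡⟨ cong (recip (suc M) *_) ι1≡1 ⟨
  recip (suc M) * ι 1           ≤⟨ ℚ.*-monoˡ-≤-nonNeg (recip (suc M)) {{ℚ.nonNegative (0≤recip (suc M))}}
                                     (ι-mono-≤ (ℕ.s≤s ℕ.z≤n)) ⟩
  recip (suc M) * ι (suc M)     ≡⟨ recip-inverseˡ (suc M) ⟩
  1ℚ                            ∎)
  where open ℚ.≤-Reasoning

-- The decay comes from β = n!(n+k)!/(2n+k+1)!: since n!(n+k)! ≤ (2n+k)!, it is at most 1/(2n+k+1).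
-- The bound M is a separate parameter because the large index is the row on the edge of F but the
-- column on the edge of G; both edges then share the same c.
module _ (n k M : ℕ) (M≤e : M ℕ.≤ double n ℕ.+ k) where
  private
    e = double n ℕ.+ k
    c = recip (suc M)
    a = ι (suc n)
    s = ι (suc (suc e))
    t = ι (suc e)
    p = fac n
    r = fac (n ℕ.+ k)
    β = p * r * inv! (suc e)

    βt∈ : β * t ∈[0, 1ℚ ]
    βt∈ = subst (_∈[0, 1ℚ ])
      (begin
        ι (n ! ℕ.* (n ℕ.+ k) !) * inv! e  ≡⟨ cong₂ _*_ (ι-* (n !) ((n ℕ.+ k) !)) (inv!-suc e) ⟩
        p * r * (inv! (suc e) * t)        ≡⟨ ℚ.*-assoc (p * r) (inv! (suc e)) t ⟨
        β * t                             ∎)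
      (ι*inv!∈[0,1] _ e (n!*[n+k]!≤ n k))
      where open ≡-Reasoning

    0≤β : 0ℚ ≤ β
    0≤β = 0≤* (0≤* (0≤fac n) (0≤fac (n ℕ.+ k))) (0≤inv! (suc e))

    β∈c : β ∈[0, c ]
    β∈c = ≤recip M 0≤β (proj₂ βt∈) (ℕ.s≤s M≤e)

    β∈1 : β ∈[0, 1ℚ ]
    β∈1 = ∈-trans β∈c (proj₂ (recip∈[0,1] M))

    u = ι (suc (n ℕ.+ k))

    βu∈ : β * u ∈[0, 1ℚ ]
    βu∈ = ∈-trans (0≤* 0≤β (0≤ι (suc (n ℕ.+ k))) , ℚ.*-monoˡ-≤-nonNeg β {{ℚ.nonNegative 0≤β}}
      (ι-mono-≤ (ℕ.s≤s (ℕ.+-monoˡ-≤ k (n≤double n))))) (proj₂ βt∈)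

    s≡t+1 : s ≡ t + 1ℚ
    s≡t+1 = ι-suc (suc e)

    f≡t+u : f a s ≡ t + u
    f≡t+u = begin
      2ℚ * s ℚ.- a ℚ.- 1ℚ          ≡⟨ solve 2 (λ s a → con 2ℚ :* s :- a :- con 1ℚ := s :- con 1ℚ :+ (s :- a)) refl s a ⟩
      s ℚ.- 1ℚ + (s ℚ.- a)         ≡⟨ cong₂ (λ x y → x ℚ.- 1ℚ + y) s≡t+1 (sym (ι-suc-+ n k)) ⟩
      t + 1ℚ ℚ.- 1ℚ + u            ≡⟨ solve 2 (λ t u → t :+ con 1ℚ :- con 1ℚ :+ u := t :+ u) refl t u ⟩
      t + u                        ∎
      where open ≡-Reasoning

  -- The weight is n!²/(2n)! times β⁴. Two of the factors β give c², one is bounded by 1, and the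
  -- last absorbs the linear factor t + u, as βt and βu are at most 1.
  ∣F∣≤ : ℚ.∣ F n k ∣ ≤ 2ℚ * (c * c)
  ∣F∣≤ = begin
    ℚ.∣ F n k ∣
      ≡⟨ ∣sign*x∣ n _ ⟩
    ℚ.∣ weight p r i j * f a s ∣
      ≡⟨ cong ℚ.∣_∣ (trans (cong (weight p r i j *_) f≡t+u) (regroup p r i j t u)) ⟩
    ℚ.∣ p * p * i * (β * β * β * (β * t + β * u)) ∣
      ≡⟨ ℚ.0≤p⇒∣p∣≡p (proj₁ product∈) ⟩
    p * p * i * (β * β * β * (β * t + β * u))
      ≤⟨ proj₂ product∈ ⟩
    1ℚ * (c * c * 1ℚ * (1ℚ + 1ℚ))
      ≡⟨ solve 1 (λ c → con 1ℚ :* (c :* c :* con 1ℚ :* (con 1ℚ :+ con 1ℚ)) := con 2ℚ :* (c :* c)) refl c ⟩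
    2ℚ * (c * c) ∎
    where
    open ℚ.≤-Reasoning
    i = inv! (double n)
    j = inv! (suc e)
    regroup : ∀ p r i j t u → weight p r i j * (t + u) ≡
      p * p * i * (p * r * j * (p * r * j) * (p * r * j) * (p * r * j * t + p * r * j * u))
    regroup = solve 6 (λ p r i j t u → let β = p :* r :* j in
      :weight p r i j :* (t :+ u)
        := p :* p :* i :* (β :* β :* β :* (β :* t :+ β :* u))) refl
    ppi∈ : p * p * i ∈[0, 1ℚ ]
    ppi∈ = subst (λ x → x * i ∈[0, 1ℚ ]) (ι-* (n !) (n !)) (ι*inv!∈[0,1] _ (double n)
      (ℕ.≤-trans (m!*n!≤[m+n]! n n) (ℕ.≤-reflexive (cong _! (sym (double≡+ n))))))
    product∈ : p * p * i * (β * β * β * (β * t + β * u)) ∈[0, 1ℚ * (c * c * 1ℚ * (1ℚ + 1ℚ)) ]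
    product∈ = ∈-* ppi∈ (∈-* (∈-* (∈-* β∈c β∈c) β∈1) (∈-+ βt∈ βu∈))

  -- Because 0 ≤ a ≤ s and 0 ≤ s - 1 ≤ s, the parts X and Y together are at most 8s⁶. With δs = β
  -- this gives δ⁴s⁶ = β²(βs)², where β ≤ c and βs = βt + β ≤ 2; hence 32 = 8 · 2 · 2. The factor a
  -- of g is absorbed by n!²(n+1) ≤ (2n+2)!.
  ∣G∣≤ : ℚ.∣ G n k ∣ ≤ fromℤ (+ 32) * (c * c)
  ∣G∣≤ = begin
    ℚ.∣ G n k ∣
      ≡⟨ ∣sign*x∣ n _ ⟩
    ℚ.∣ weight p r i j * (a * X ℚ.- a * Y) ∣
      ≡⟨ cong ℚ.∣_∣ (regroup p r i j a X Y) ⟩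
    ℚ.∣ p * p * i * a * δ ⁴ * (X ℚ.- Y) ∣
      ≡⟨ ℚ.∣p*q∣≡∣p∣*∣q∣ (p * p * i * a * δ ⁴) (X ℚ.- Y) ⟩
    ℚ.∣ p * p * i * a * δ ⁴ ∣ * ℚ.∣ X ℚ.- Y ∣
      ≡⟨ cong (_* ℚ.∣ X ℚ.- Y ∣) (ℚ.0≤p⇒∣p∣≡p 0≤v) ⟩
    p * p * i * a * δ ⁴ * ℚ.∣ X ℚ.- Y ∣
      ≤⟨ ℚ.*-monoˡ-≤-nonNeg (p * p * i * a * δ ⁴) {{ℚ.nonNegative 0≤v}} (∣x-y∣≤ X∈ Y∈) ⟩
    p * p * i * a * δ ⁴ *
      (s ⁴ * (2ℚ * (s * s) + 2ℚ * (s * s) + s * s) + s * s * s ⁴ + 2ℚ * (s * s ⁴ * s))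
      ≡⟨ collect p i a δ s ⟩
    p * p * i * a * (fromℤ (+ 8) * (δ * s * (δ * s) * (δ * s * s) * (δ * s * s)))
      ≡⟨ cong (λ x → p * p * i * a * (fromℤ (+ 8) * (x * x * (x * s) * (x * s)))) δs≡β ⟩
    p * p * i * a * (fromℤ (+ 8) * (β * β * (β * s) * (β * s)))
      ≤⟨ proj₂ (∈-* ppia∈ (∈-* (∈-refl (ℚ.nonNegative⁻¹ (fromℤ (+ 8)))) (∈-* (∈-* (∈-* β∈c β∈c) βs∈) βs∈))) ⟩
    1ℚ * (fromℤ (+ 8) * (c * c * (1ℚ + 1ℚ) * (1ℚ + 1ℚ)))
      ≡⟨ solve 1 (λ c → con 1ℚ :* (con (fromℤ (+ 8)) :* (c :* c :* (con 1ℚ :+ con 1ℚ) :* (con 1ℚ :+ con 1ℚ)))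
           := con (fromℤ (+ 32)) :* (c :* c)) refl c ⟩
    fromℤ (+ 32) * (c * c) ∎
    where
    open ℚ.≤-Reasoning
    i = inv! (double (suc n))
    j = inv! (suc (suc e))
    δ = p * r * j
    X = s ⁴ * (2ℚ * ((s ℚ.- 1ℚ) * (s ℚ.- 1ℚ)) + 2ℚ * (a * (s ℚ.- 1ℚ)) + a * a) + a * a * a ⁴
    Y = 2ℚ * (a * a ⁴ * s)

    regroup : ∀ p r i j a X Y → weight p r i j * (a * X ℚ.- a * Y) ≡
      p * p * i * a * (p * r * j) ⁴ * (X ℚ.- Y)
    regroup = solve 7 (λ p r i j a X Y → let β = p :* r :* j in
      :weight p r i j :* (a :* X :- a :* Y) := p :* p :* i :* a :* β :⁴ :* (X :- Y)) refl

    collect : ∀ p i a δ s → p * p * i * a * δ ⁴ *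
      (s ⁴ * (2ℚ * (s * s) + 2ℚ * (s * s) + s * s) + s * s * s ⁴ + 2ℚ * (s * s ⁴ * s)) ≡
      p * p * i * a * (fromℤ (+ 8) * (δ * s * (δ * s) * (δ * s * s) * (δ * s * s)))
    collect = solve 5 (λ p i a δ s → let 2s² = :2 :* (s :* s) in
      p :* p :* i :* a :* δ :⁴ :*
        (s :⁴ :* (2s² :+ 2s² :+ s :* s) :+ s :* s :* s :⁴ :+ :2 :* (s :* s :⁴ :* s))
      := p :* p :* i :* a :* (con (fromℤ (+ 8)) :* (δ :* s :* (δ :* s) :* (δ :* s :* s) :* (δ :* s :* s)))) refl

    δs≡β : δ * s ≡ β
    δs≡β = trans (ℚ.*-assoc (p * r) j s) (cong (p * r *_) (sym (inv!-suc (suc e))))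

    ppia∈ : p * p * i * a ∈[0, 1ℚ ]
    ppia∈ = subst (_∈[0, 1ℚ ])
      (trans (cong (_* i) (trans (ι-* (n ! ℕ.* n !) (suc n)) (cong (_* a) (ι-* (n !) (n !)))))
             (solve 3 (λ x a i → x :* a :* i := x :* i :* a) refl (p * p) a i))
      (ι*inv!∈[0,1] _ (double (suc n)) (ℕ.≤-trans (n!*n!*[1+n]≤ n)
        (ℕ.≤-trans (ℕ.m≤n*m _ (suc (double n))) (ℕ.m≤n*m _ (suc (suc (double n)))))))

    0≤s : 0ℚ ≤ s
    0≤s = 0≤ι (suc (suc e))

    0≤δ : 0ℚ ≤ δ
    0≤δ = 0≤* (0≤* (0≤fac n) (0≤fac (n ℕ.+ k))) (0≤inv! (suc (suc e)))

    ∈-⁴ : ∀ {x b} → x ∈[0, b ] → x ⁴ ∈[0, b ⁴ ]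
    ∈-⁴ x∈ = ∈-* (∈-* x∈ x∈) (∈-* x∈ x∈)

    0≤v : 0ℚ ≤ p * p * i * a * δ ⁴
    0≤v = 0≤* (proj₁ ppia∈) (proj₁ (∈-⁴ (∈-refl 0≤δ)))

    βs∈ : β * s ∈[0, 1ℚ + 1ℚ ]
    βs∈ = subst (_∈[0, 1ℚ + 1ℚ ])
      (trans (solve 2 (λ β t → β :* t :+ β := β :* (t :+ con 1ℚ)) refl β t) (cong (β *_) (sym s≡t+1)))
      (∈-+ βt∈ β∈1)

    s∈ : s ∈[0, s ]
    s∈ = ∈-refl 0≤s

    a∈ : a ∈[0, s ]
    a∈ = 0≤ι (suc n) , ι-mono-≤ (ℕ.s≤s (ℕ.≤-trans (n≤double n) (ℕ.≤-trans (ℕ.m≤m+n (double n) k) (ℕ.n≤1+n e))))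

    t∈ : s ℚ.- 1ℚ ∈[0, s ]
    t∈ = subst (_∈[0, s ])
      (trans (solve 1 (λ t → t := t :+ con 1ℚ :- con 1ℚ) refl t) (cong (ℚ._- 1ℚ) (sym s≡t+1)))
      (0≤ι (suc e) , ι-mono-≤ (ℕ.n≤1+n (suc e)))

    2∈ : 2ℚ ∈[0, 2ℚ ]
    2∈ = ∈-refl (ℚ.nonNegative⁻¹ 2ℚ)

    X∈ : X ∈[0, s ⁴ * (2ℚ * (s * s) + 2ℚ * (s * s) + s * s) + s * s * s ⁴ ]
    X∈ = ∈-+ (∈-* (∈-⁴ s∈) (∈-+ (∈-+ (∈-* 2∈ (∈-* t∈ t∈)) (∈-* 2∈ (∈-* a∈ t∈))) (∈-* a∈ a∈)))
             (∈-* (∈-* a∈ a∈) (∈-⁴ a∈))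

    Y∈ : Y ∈[0, 2ℚ * (s * s ⁴ * s) ]
    Y∈ = ∈-* 2∈ (∈-* (∈-* a∈ (∈-⁴ a∈)) s∈)

-- The summand

fromℤ-^ : ∀ i n → fromℤ (i ℤ.^ n) ≡ fromℤ i ^ n
fromℤ-^ i zero    = refl
fromℤ-^ i (suc n) = trans (fromℤ-* i (i ℤ.^ n)) (cong (fromℤ i *_) (fromℤ-^ i n))

ι-^ : ∀ m n → ι (m ℕ.^ n) ≡ ι m ^ n
ι-^ m zero    = ι1≡1
ι-^ m (suc n) = trans (ι-* m (m ℕ.^ n)) (cong (ι m *_) (ι-^ m n))

infix 8 _⁵
_⁵ : ℚ → ℚ
x ⁵ = x * x ⁴

-- In `T-certificate`, m⁵ = 32a⁵(2a-1)⁵ and g a (2a) = a⁵(205a² - 160a + 32). So (2a-1)⁵ has to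
-- divide 32(205a² - 160a + 32) + a⁵ q(a). As a is invertible modulo (2a-1)⁵, this determines q
-- among the polynomials of degree at most 4, and P is then found by division. The signs are
-- separated for the estimate of D.
q⁺ q⁻ q : ℚ → ℚ
q⁺ x = fromℤ (+ 1845760) * x + fromℤ (+ 7106560) * (x * x * x)
q⁻ x = fromℤ (+ 231168) + fromℤ (+ 5478400) * (x * x) + fromℤ (+ 3420160) * x ⁴
q x = q⁺ x ℚ.- q⁻ x

P : ℚ → ℚ
P x = fromℤ (+ 684700) * x ⁴ ℚ.- fromℤ (+ 1418358) * (x * x * x)
  + fromℤ (+ 1100639) * (x * x) ℚ.- fromℤ (+ 365392) * x + fromℤ (+ 47327)

-- Written with factorials so that it shares the factor k!²/(2k+2)! with `G k 0`;
-- `ι-centralBinomial*1/C` connects it to the binomial coefficient.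
1/C : ℕ → ℚ
1/C n = fac n * fac n * inv! (double n)

D : ℕ → ℚ
D n = sign n * (1/C n ⁵ * q (ι n))

5ℚ : ℚ
5ℚ = fromℤ (+ 5)

T : ℕ → ℚ
T k = sign k * (1/C k ⁵ * P (ι k))

private
  infix 9 _:⁵
  _:⁵ : ∀ {m} → Polynomial m → Polynomial m
  x :⁵ = x :* x :⁴

  :ℤ : ∀ {m} → ℤ → Polynomial m
  :ℤ i = con (fromℤ i)

  :q :P : ∀ {m} → Polynomial m → Polynomial m
  :q x = :ℤ (+ 1845760) :* x :+ :ℤ (+ 7106560) :* (x :* x :* x)
    :- (:ℤ (+ 231168) :+ :ℤ (+ 5478400) :* (x :* x) :+ :ℤ (+ 3420160) :* x :⁴)
  :P x = :ℤ (+ 684700) :* x :⁴ :- :ℤ (+ 1418358) :* (x :* x :* x)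
    :+ :ℤ (+ 1100639) :* (x :* x) :- :ℤ (+ 365392) :* x :+ :ℤ (+ 47327)

-- With v = k!²/(2k+2)!, the reciprocals of C(2k,k) and C(2k+2,k+1) are mv and a²v, and at k = 0 in
-- the second index the weight of G collapses to v⁵. This identity is what remains after dividing by
-- (-1)ᵏ v⁵.
T-certificate : ∀ x → let a = x + 1ℚ ; m = (2ℚ * a ℚ.- 1ℚ) * (2ℚ * a) in
  5ℚ * (m ⁵ * P x) ≡ - (fromℤ (+ 32) * g a (2ℚ * a)) + (- ((a * a) ⁵ * q a) ℚ.- m ⁵ * q x)
T-certificate = solve 1 (λ x → let a = x :+ con 1ℚ ; m = (con 2ℚ :* a :- con 1ℚ) :* (con 2ℚ :* a) in
  con 5ℚ :* (m :⁵ :* :P x)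
    := :- (:ℤ (+ 32) :* :g a (con 2ℚ :* a)) :+ (:- ((a :* a) :⁵ :* :q a) :- m :⁵ :* :q x)) refl

T-telescope : ∀ k → 5ℚ * T k ≡ - (fromℤ (+ 32) * G k 0) + (D (suc k) ℚ.- D k)
T-telescope k = begin
  5ℚ * (σ * (1/C k ⁵ * P x))
    ≡⟨ cong (λ y → 5ℚ * (σ * (y ⁵ * P x))) 1/C≡ ⟩
  5ℚ * (σ * ((m * v) ⁵ * P x))
    ≡⟨ solve 4 (λ σ m v y → con 5ℚ :* (σ :* ((m :* v) :⁵ :* y)) := σ :* v :⁵ :* (con 5ℚ :* (m :⁵ :* y)))
         refl σ m v (P x) ⟩
  σ * v ⁵ * (5ℚ * (m ⁵ * P x))
    ≡⟨ cong (σ * v ⁵ *_) (T-certificate x) ⟩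
  σ * v ⁵ * (- (fromℤ (+ 32) * g a (2ℚ * a)) + (- ((a * a) ⁵ * q a) ℚ.- m ⁵ * q x))
    ≡⟨ solve 7 (λ σ v m a u y z →
         σ :* v :⁵ :* (:- (:ℤ (+ 32) :* u) :+ (:- ((a :* a) :⁵ :* y) :- m :⁵ :* z))
           := :- (:ℤ (+ 32) :* (σ :* (v :⁵ :* u)))
                :+ ((:- σ) :* ((a :* a :* v) :⁵ :* y) :- σ :* ((m :* v) :⁵ :* z)))
         refl σ v m a (g a (2ℚ * a)) (q a) (q x) ⟩
  - (fromℤ (+ 32) * (σ * (v ⁵ * g a (2ℚ * a)))) + ((- σ) * ((a * a * v) ⁵ * q a) ℚ.- σ * ((m * v) ⁵ * q x))
    ≡⟨ cong₂ (λ y z → - (fromℤ (+ 32) * y) + z) G≡ (cong₂ ℚ._-_ D′≡ (cong (λ y → σ * (y ⁵ * q x)) 1/C≡)) ⟨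
  - (fromℤ (+ 32) * G k 0) + (D (suc k) ℚ.- D k) ∎
  where
  open ≡-Reasoning
  σ = sign k
  x = ι k
  a = x + 1ℚ
  m = (2ℚ * a ℚ.- 1ℚ) * (2ℚ * a)
  p = fac k
  i = inv! (double (suc k))
  v = p * p * i

  1/C≡ : 1/C k ≡ m * v
  1/C≡ = begin
    p * p * inv! (double k)
      ≡⟨ cong (p * p *_) (inv!-double k) ⟩
    p * p * ((2ℚ * ι (suc k) ℚ.- 1ℚ) * (2ℚ * ι (suc k)) * i)
      ≡⟨ cong (λ y → p * p * ((2ℚ * y ℚ.- 1ℚ) * (2ℚ * y) * i)) (ι-suc k) ⟩
    p * p * (m * i)
      ≡⟨ solve 3 (λ p m i → p :* p :* (m :* i) := m :* (p :* p :* i)) refl p m i ⟩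
    m * v ∎

  D′≡ : D (suc k) ≡ (- σ) * ((a * a * v) ⁵ * q a)
  D′≡ = cong₂ _*_ (sign-suc k) (cong₂ (λ y z → y ⁵ * q z)
    (begin
      fac (suc k) * fac (suc k) * i
        ≡⟨ cong (λ y → y * y * i) (trans (fac-suc k) (cong (_* p) (ι-suc k))) ⟩
      a * p * (a * p) * i
        ≡⟨ solve 3 (λ a p i → a :* p :* (a :* p) :* i := a :* a :* (p :* p :* i)) refl a p i ⟩
      a * a * v ∎)
    (ι-suc k))

  G≡ : G k 0 ≡ σ * (v ⁵ * g a (2ℚ * a))
  G≡ = begin
    G k 0
      ≡⟨ cong₂ (λ m m′ → σ * (weight p (fac m) i (inv! (suc (suc m′))) * g (ι (suc k)) (ι (suc (suc m′)))))
           (ℕ.+-identityʳ k) (ℕ.+-identityʳ (double k)) ⟩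
    σ * (weight p p i i * g (ι (suc k)) (ι (double (suc k))))
      ≡⟨ cong₂ (λ y z → σ * (y * z))
           (solve 2 (λ p i → p :* p :* p :⁴ :* p :⁴ :* i :* i :⁴ := (p :* p :* i) :⁵) refl p i)
           (cong₂ g (ι-suc k) (trans (ι-double (suc k)) (cong (2ℚ *_) (ι-suc k)))) ⟩
    σ * (v ⁵ * g a (2ℚ * a)) ∎

module _ (n : ℕ) where
  private
    c = recip (suc n)
    b = 1/C n
    x = ι n

    0≤b : 0ℚ ≤ b
    0≤b = 0≤* (0≤* (0≤fac n) (0≤fac n)) (0≤inv! (double n))

    ba≤1 : b * ι (suc n) ≤ 1ℚ
    ba≤1 = subst (_≤ 1ℚ)
      (trans (cong (_* inv! (double n)) (trans (ι-* (n ! ℕ.* n !) (suc n)) (cong (_* ι (suc n)) (ι-* (n !) (n !)))))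
             (solve 3 (λ x a i → x :* a :* i := x :* i :* a) refl (fac n * fac n) (ι (suc n)) (inv! (double n))))
      (proj₂ (ι*inv!∈[0,1] _ (double n) (n!*n!*[1+n]≤ n)))

    b∈c : b ∈[0, c ]
    b∈c = ≤recip n 0≤b ba≤1 ℕ.≤-refl

    b∈1 : b ∈[0, 1ℚ ]
    b∈1 = ∈-trans b∈c (proj₂ (recip∈[0,1] n))

    u∈1 : b * x ∈[0, 1ℚ ]
    u∈1 = 0≤* 0≤b (0≤ι n) ,
      ℚ.≤-trans (ℚ.*-monoˡ-≤-nonNeg b {{ℚ.nonNegative 0≤b}} (ι-mono-≤ (ℕ.n≤1+n n))) ba≤1

  -- Five powers of b = 1/C(2n,n) face a quartic: four of them turn each monomial into a product of
  -- factors b and bn, all at most 1, and the fifth supplies c. The constant is the sum of the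
  -- absolute values of the coefficients of q.
  ∣D∣≤ : ℚ.∣ D n ∣ ≤ fromℤ (+ 18082048) * c
  ∣D∣≤ = begin
    ℚ.∣ D n ∣                             ≡⟨ ∣sign*x∣ n _ ⟩
    ℚ.∣ b ⁵ * q x ∣                       ≡⟨ cong ℚ.∣_∣ (homogenise b x) ⟩
    ℚ.∣ b * (X ℚ.- Y) ∣                   ≡⟨ ℚ.∣p*q∣≡∣p∣*∣q∣ b (X ℚ.- Y) ⟩
    ℚ.∣ b ∣ * ℚ.∣ X ℚ.- Y ∣               ≡⟨ cong (_* ℚ.∣ X ℚ.- Y ∣) (ℚ.0≤p⇒∣p∣≡p 0≤b) ⟩
    b * ℚ.∣ X ℚ.- Y ∣                     ≤⟨ proj₂ (∈-* b∈c (ℚ.0≤∣p∣ (X ℚ.- Y) , ∣x-y∣≤ X∈ Y∈)) ⟩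
    c * fromℤ (+ 18082048)                ≡⟨ ℚ.*-comm c _ ⟩
    fromℤ (+ 18082048) * c                ∎
    where
    open ℚ.≤-Reasoning
    u = b * x
    k₀ = fromℤ (+ 231168)
    k₁ = fromℤ (+ 1845760)
    k₂ = fromℤ (+ 5478400)
    k₃ = fromℤ (+ 7106560)
    k₄ = fromℤ (+ 3420160)
    X = k₁ * (u * (b * b * b)) + k₃ * (u * u * u * b)
    Y = k₀ * b ⁴ + k₂ * (u * u * (b * b)) + k₄ * u ⁴

    homogenise : ∀ b x → let u = b * x in b ⁵ * q x ≡
      b * (k₁ * (u * (b * b * b)) + k₃ * (u * u * u * b) ℚ.- (k₀ * b ⁴ + k₂ * (u * u * (b * b)) + k₄ * u ⁴))
    homogenise = solve 2 (λ b x → let u = b :* x in b :⁵ :* :q x :=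
      b :* (con k₁ :* (u :* (b :* b :* b)) :+ con k₃ :* (u :* u :* u :* b)
        :- (con k₀ :* b :⁴ :+ con k₂ :* (u :* u :* (b :* b)) :+ con k₄ :* u :⁴))) refl

    scaled : ∀ {y} k .{{_ : ℚ.NonNegative k}} → y ∈[0, 1ℚ ] → k * y ∈[0, k ]
    scaled k y∈ = ∈-trans (∈-* (∈-refl (ℚ.nonNegative⁻¹ k)) y∈) (ℚ.≤-reflexive (ℚ.*-identityʳ k))

    X∈ : X ∈[0, k₁ + k₃ ]
    X∈ = ∈-+ (scaled k₁ (∈-* u∈1 (∈-* (∈-* b∈1 b∈1) b∈1)))
             (scaled k₃ (∈-* (∈-* (∈-* u∈1 u∈1) u∈1) b∈1))

    Y∈ : Y ∈[0, k₀ + k₂ + k₄ ]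
    Y∈ = ∈-+ (∈-+ (scaled k₀ (∈-* (∈-* b∈1 b∈1) (∈-* b∈1 b∈1)))
                  (scaled k₂ (∈-* (∈-* u∈1 u∈1) (∈-* b∈1 b∈1))))
             (scaled k₄ (∈-* (∈-* u∈1 u∈1) (∈-* u∈1 u∈1)))

-- The edge n = 0 and the summand as stated

F₀≡2ζ3-term : ∀ k → F 0 k ≡ 2ℚ * ζ3-term k
F₀≡2ζ3-term k = begin
  F 0 k
    ≡⟨ cong₂ (λ σ w → σ * (w * f (ι 1) (ι (suc (suc k))))) sign0
         (cong₂ (λ x y → weight x (fac k) y (inv! (suc k))) ι1≡1 inv!0) ⟩
  1ℚ * (weight 1ℚ (fac k) 1ℚ (inv! (suc k)) * f (ι 1) (ι (suc (suc k))))
    ≡⟨ cong₂ (λ x y → 1ℚ * (weight 1ℚ (fac k) 1ℚ (inv! (suc k)) * f x y)) ι1≡1 (ι-suc (suc k)) ⟩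
  1ℚ * (weight 1ℚ (fac k) 1ℚ (inv! (suc k)) * f 1ℚ (z + 1ℚ))
    ≡⟨ solve 3 (λ p i z → con 1ℚ :* (con 1ℚ :* con 1ℚ :* con 1ℚ :⁴ :* p :⁴ :* con 1ℚ :* i :⁴
           :* (con 2ℚ :* (z :+ con 1ℚ) :- con 1ℚ :- con 1ℚ))
         := con 2ℚ :* (p :* i :* (p :* i) :* (p :* i) :* (i :* z :* p))) refl (fac k) (inv! (suc k)) z ⟩
  2ℚ * (y * y * y * (inv! (suc k) * z * fac k))
    ≡⟨ cong (λ w → 2ℚ * (y * y * y * w)) yz≡1 ⟩
  2ℚ * (y * y * y * 1ℚ)
    -- Both y³ and `ζ3-term k` are inverse to z³; inserting 1 in this form exchanges one for the
    -- other.
    ≡⟨ cong (λ w → 2ℚ * (y * y * y * w)) ζz³≡1 ⟨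
  2ℚ * (y * y * y * (ζ3-term k * (z * (z * (z * 1ℚ)))))
    ≡⟨ solve 4 (λ ζ p i z → con 2ℚ :* (p :* i :* (p :* i) :* (p :* i) :* (ζ :* (z :* (z :* (z :* con 1ℚ)))))
         := con 2ℚ :* (ζ :* (i :* z :* p :* (i :* z :* p) :* (i :* z :* p)))) refl (ζ3-term k) (fac k) (inv! (suc k)) z ⟩
  2ℚ * (ζ3-term k * (inv! (suc k) * z * fac k * (inv! (suc k) * z * fac k) * (inv! (suc k) * z * fac k)))
    ≡⟨ cong (λ w → 2ℚ * (ζ3-term k * (w * w * w))) yz≡1 ⟩
  2ℚ * (ζ3-term k * (1ℚ * 1ℚ * 1ℚ))
    ≡⟨ solve 1 (λ ζ → con 2ℚ :* (ζ :* (con 1ℚ :* con 1ℚ :* con 1ℚ)) := con 2ℚ :* ζ) refl (ζ3-term k) ⟩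
  2ℚ * ζ3-term k ∎
  where
  open ≡-Reasoning
  z = ι (suc k)
  y = fac k * inv! (suc k)

  sign0 : sign 0 ≡ 1ℚ
  sign0 = sign-def 0

  inv!0 : inv! 0 ≡ 1ℚ
  inv!0 = trans (trans (sym (ℚ.*-identityʳ (inv! 0))) (cong (inv! 0 *_) (sym ι1≡1))) (inv!-inverseˡ 0)

  yz≡1 : inv! (suc k) * z * fac k ≡ 1ℚ
  yz≡1 = trans (cong (_* fac k) (sym (inv!-suc k))) (inv!-inverseˡ k)

  ζz³≡1 : ζ3-term k * (z * (z * (z * 1ℚ))) ≡ 1ℚ
  ζz³≡1 = trans (cong (ζ3-term k *_) (sym z³)) (/-*-cancel (+ 1) (suc k ℕ.^ 3) {{ℕ.m^n≢0 (suc k) 3}})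
    where
    z³ : fromℤ (+ (suc k ℕ.^ 3)) ≡ z * (z * (z * 1ℚ))
    z³ = trans (sym (ι-def (suc k ℕ.^ 3))) (ι-^ (suc k) 3)

centralBinomial*k!*k! : ∀ k → centralBinomial k ℕ.* (k ! ℕ.* k !) ≡ double k !
centralBinomial*k!*k! k = begin
  centralBinomial k ℕ.* (k ! ℕ.* k !)
    ≡⟨ cong (λ m → centralBinomial k ℕ.* (k ! ℕ.* m !)) (trans (ℕ.m+n∸m≡n k (k ℕ.+ 0)) (ℕ.+-identityʳ k)) ⟨
  centralBinomial k ℕ.* (k ! ℕ.* (2 ℕ.* k ℕ.∸ k) !)
    ≡⟨ cong (ℕ._* (k ! ℕ.* (2 ℕ.* k ℕ.∸ k) !)) (nCk≡n!/k![n-k]! k≤2k) ⟩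
  _ ≡⟨ m/n*n≡m {{k ℕ.!* (2 ℕ.* k ℕ.∸ k) !≢0}} (k![n∸k]!∣n! k≤2k) ⟩
  (2 ℕ.* k) !
    ≡⟨ cong _! (double≡2* k) ⟨
  double k ! ∎
  where
  open ≡-Reasoning
  k≤2k : k ℕ.≤ 2 ℕ.* k
  k≤2k = ℕ.m≤m+n k (k ℕ.+ 0)

ι-centralBinomial*1/C : ∀ k → ι (centralBinomial k) * 1/C k ≡ 1ℚ
ι-centralBinomial*1/C k = begin
  ι C * (fac k * fac k * inv! (double k))
    ≡⟨ ℚ.*-assoc (ι C) (fac k * fac k) (inv! (double k)) ⟨
  ι C * (fac k * fac k) * inv! (double k)
    ≡⟨ cong (_* inv! (double k)) (trans (ι-* C _) (cong (ι C *_) (ι-* (k !) (k !)))) ⟨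
  ι (C ℕ.* (k ! ℕ.* k !)) * inv! (double k)
    ≡⟨ cong (λ m → ι m * inv! (double k)) (centralBinomial*k!*k! k) ⟩
  fac (double k) * inv! (double k)
    ≡⟨ trans (ℚ.*-comm (fac (double k)) _) (inv!-inverseˡ (double k)) ⟩
  1ℚ ∎
  where
  open ≡-Reasoning
  C = centralBinomial k

sign/C⁵ : ∀ k → ℚ._/_ (-1ℤ ℤ.^ k) (centralBinomial k ℕ.^ 5) {{centralBinomial^≢0 k 5}} ≡ sign k * 1/C k ⁵
sign/C⁵ k = begin
  x                                        ≡⟨ ℚ.*-identityʳ x ⟨
  x * 1ℚ ⁵                                 ≡⟨ cong (λ y → x * y ⁵) (ι-centralBinomial*1/C k) ⟨
  x * (z * b) ⁵                            ≡⟨ solve 3 (λ x z b → x :* (z :* b) :⁵ := x :* (z :* (z :* (z :* (z :* (z :* con 1ℚ))))) :* b :⁵) refl x z b ⟩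
  x * z ^ 5 * b ⁵                          ≡⟨ cong (λ y → x * y * b ⁵) (trans (sym (ι-^ C 5)) (ι-def (C ℕ.^ 5))) ⟩
  x * fromℤ (+ (C ℕ.^ 5)) * b ⁵            ≡⟨ cong (_* b ⁵) (/-*-cancel (-1ℤ ℤ.^ k) (C ℕ.^ 5) {{centralBinomial^≢0 k 5}}) ⟩
  fromℤ (-1ℤ ℤ.^ k) * b ⁵                  ≡⟨ cong (_* b ⁵) (sign-def k) ⟨
  sign k * b ⁵                             ∎
  where
  open ≡-Reasoning
  C = centralBinomial k
  z = ι C
  b = 1/C k
  x = ℚ._/_ (-1ℤ ℤ.^ k) (C ℕ.^ 5) {{centralBinomial^≢0 k 5}}

fromℤ-P : ∀ k → fromℤ (+ 684700 ℤ.* (+ k) ℤ.^ 4 ℤ.- + 1418358 ℤ.* (+ k) ℤ.^ 3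
    ℤ.+ + 1100639 ℤ.* (+ k) ℤ.^ 2 ℤ.- + 365392 ℤ.* + k ℤ.+ + 47327) ≡ P (ι k)
fromℤ-P k = trans
  (image (+↦ (-↦ (+↦ (-↦ (*↦ (ℤ↦ (+ 684700)) (^↦ 4)) (*↦ (ℤ↦ (+ 1418358)) (^↦ 3))) (*↦ (ℤ↦ (+ 1100639)) (^↦ 2)))
      (*↦ (ℤ↦ (+ 365392)) k↦)) (ℤ↦ (+ 47327))))
  (solve 1 (λ x → :ℤ (+ 684700) :* (x :* (x :* (x :* (x :* con 1ℚ))))
      :- :ℤ (+ 1418358) :* (x :* (x :* (x :* con 1ℚ)))
      :+ :ℤ (+ 1100639) :* (x :* (x :* con 1ℚ)) :- :ℤ (+ 365392) :* x :+ :ℤ (+ 47327)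
    := :P x) refl (ι k))
  where
  -- A data type, since unification cannot recover i from an equation fromℤ i ≡ x.
  data _↦_ (i : ℤ) (x : ℚ) : Set where
    mk : fromℤ i ≡ x → i ↦ x
  image : ∀ {i x} → i ↦ x → fromℤ i ≡ x
  image (mk eq) = eq
  +↦ : ∀ {i j x y} → i ↦ x → j ↦ y → (i ℤ.+ j) ↦ (x + y)
  +↦ {i} {j} (mk refl) (mk refl) = mk (fromℤ-+ i j)
  -↦ : ∀ {i j x y} → i ↦ x → j ↦ y → (i ℤ.- j) ↦ (x ℚ.- y)
  -↦ {i} {j} (mk refl) (mk refl) = mk (fromℤ-- i j)
  *↦ : ∀ {i j x y} → i ↦ x → j ↦ y → (i ℤ.* j) ↦ (x * y)
  *↦ {i} {j} (mk refl) (mk refl) = mk (fromℤ-* i j)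
  ℤ↦ : ∀ i → i ↦ fromℤ i
  ℤ↦ i = mk refl
  k↦ : (+ k) ↦ ι k
  k↦ = mk (sym (ι-def k))
  ^↦ : ∀ n → ((+ k) ℤ.^ n) ↦ (ι k ^ n)
  ^↦ n = mk (trans (fromℤ-^ (+ k) n) (cong (_^ n) (sym (ι-def k))))

summand≡T : ∀ k →
  ℚ._/_ (-1ℤ ℤ.^ k) (centralBinomial k ℕ.^ 5) {{centralBinomial^≢0 k 5}} ℚ.*
    fromℤ (+ 684700 ℤ.* (+ k) ℤ.^ 4 ℤ.- + 1418358 ℤ.* (+ k) ℤ.^ 3
      ℤ.+ + 1100639 ℤ.* (+ k) ℤ.^ 2 ℤ.- + 365392 ℤ.* + k ℤ.+ + 47327)
  ≡ T k
summand≡T k = trans (cong₂ _*_ (sign/C⁵ k) (fromℤ-P k)) (ℚ.*-assoc (sign k) (1/C k ⁵) (P (ι k)))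

-- Summation

partialSum-cong : ∀ {a b : ℕ → ℚ} → (∀ k → a k ≡ b k) → ∀ n → partialSum a n ≡ partialSum b n
partialSum-cong a≡b zero    = refl
partialSum-cong a≡b (suc n) = cong₂ _+_ (partialSum-cong a≡b n) (a≡b n)

partialSum-* : ∀ c a n → partialSum (λ k → c * a k) n ≡ c * partialSum a n
partialSum-* c a zero    = sym (ℚ.*-zeroʳ c)
partialSum-* c a (suc n) = trans (cong (_+ c * a n) (partialSum-* c a n))
  (sym (ℚ.*-distribˡ-+ c (partialSum a n) (a n)))

∣partialSum∣≤ : ∀ {a b} → (∀ k → ℚ.∣ a k ∣ ≤ b) → ∀ n → ℚ.∣ partialSum a n ∣ ≤ ι n * b
∣partialSum∣≤ {a} {b} ∣a∣≤b zero    = ℚ.≤-reflexive (sym (trans (cong (_* b) ι0≡0) (ℚ.*-zeroˡ b)))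
∣partialSum∣≤ {a} {b} ∣a∣≤b (suc n) = begin
  ℚ.∣ partialSum a n + a n ∣           ≤⟨ ℚ.∣p+q∣≤∣p∣+∣q∣ (partialSum a n) (a n) ⟩
  ℚ.∣ partialSum a n ∣ + ℚ.∣ a n ∣     ≤⟨ ℚ.+-mono-≤ (∣partialSum∣≤ ∣a∣≤b n) (∣a∣≤b n) ⟩
  ι n * b + b                          ≡⟨ solve 2 (λ x b → x :* b :+ b := (x :+ con 1ℚ) :* b) refl (ι n) b ⟩
  (ι n + 1ℚ) * b                       ≡⟨ cong (_* b) (ι-suc n) ⟨
  ι (suc n) * b                        ∎
  where open ℚ.≤-Reasoning

ΣF-step : ∀ n K → partialSum (F (suc n)) K ℚ.- partialSum (F n) K ≡ G n K ℚ.- G n 0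
ΣF-step n zero    = sym (ℚ.+-inverseʳ (G n 0))
ΣF-step n (suc K) = begin
  A + F (suc n) K ℚ.- (B + F n K)               ≡⟨ interchange A (F (suc n) K) B (F n K) ⟩
  (A ℚ.- B) + (F (suc n) K ℚ.- F n K)           ≡⟨ cong₂ _+_ (ΣF-step n K) (telescope n K) ⟩
  (G n K ℚ.- G n 0) + (G n (suc K) ℚ.- G n K)   ≡⟨ solve 3 (λ x y z → (x :- y) :+ (z :- x) := z :- y) refl (G n K) (G n 0) (G n (suc K)) ⟩
  G n (suc K) ℚ.- G n 0                         ∎
  where
  open ≡-Reasoning
  A = partialSum (F (suc n)) K
  B = partialSum (F n) K
  interchange : ∀ a b c d → a + b ℚ.- (c + d) ≡ (a ℚ.- c) + (b ℚ.- d)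
  interchange = solve 4 (λ a b c d → a :+ b :- (c :+ d) := (a :- c) :+ (b :- d)) refl

-- A discrete Green formula: interior differences cancel and the four edges remain.
rectangle : ∀ N K → partialSum (F N) K ℚ.- partialSum (F 0) K ≡
  partialSum (λ n → G n K) N ℚ.- partialSum (λ n → G n 0) N
rectangle zero    K = ℚ.+-inverseʳ (partialSum (F 0) K)
rectangle (suc N) K = begin
  A ℚ.- C
    ≡⟨ solve 3 (λ a b c → a :- c := (b :- c) :+ (a :- b)) refl A B C ⟩
  (B ℚ.- C) + (A ℚ.- B)
    ≡⟨ cong₂ _+_ (rectangle N K) (ΣF-step N K) ⟩
  (X ℚ.- Y) + (G N K ℚ.- G N 0)
    ≡⟨ solve 4 (λ x y u v → (x :- y) :+ (u :- v) := (x :+ u) :- (y :+ v)) refl X Y (G N K) (G N 0) ⟩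
  (X + G N K) ℚ.- (Y + G N 0) ∎
  where
  open ≡-Reasoning
  A = partialSum (F (suc N)) K
  B = partialSum (F N) K
  C = partialSum (F 0) K
  X = partialSum (λ n → G n K) N
  Y = partialSum (λ n → G n 0) N

ΣT : ∀ n → 5ℚ * partialSum T n ≡ - (fromℤ (+ 32) * partialSum (λ k → G k 0) n) + (D n ℚ.- D 0)
ΣT zero    = solve 1 (λ d → con 5ℚ :* con 0ℚ := :- (con (fromℤ (+ 32)) :* con 0ℚ) :+ (d :- d)) refl (D 0)
ΣT (suc n) = begin
  5ℚ * (S + T n)
    ≡⟨ ℚ.*-distribˡ-+ 5ℚ S (T n) ⟩
  5ℚ * S + 5ℚ * T n
    ≡⟨ cong₂ _+_ (ΣT n) (T-telescope n) ⟩
  (- (fromℤ (+ 32) * Y) + (D n ℚ.- D 0)) + (- (fromℤ (+ 32) * G n 0) + (D (suc n) ℚ.- D n))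
    ≡⟨ solve 5 (λ y g d₀ d d′ → (:- (con (fromℤ (+ 32)) :* y) :+ (d :- d₀)) :+ (:- (con (fromℤ (+ 32)) :* g) :+ (d′ :- d))
         := :- (con (fromℤ (+ 32)) :* (y :+ g)) :+ (d′ :- d₀)) refl Y (G n 0) (D 0) (D n) (D (suc n)) ⟩
  - (fromℤ (+ 32) * (Y + G n 0)) + (D (suc n) ℚ.- D 0) ∎
  where
  open ≡-Reasoning
  S = partialSum T n
  Y = partialSum (λ k → G k 0) n

D₀ : D 0 ≡ - fromℤ (+ 231168)
D₀ = begin
  sign 0 * (1/C 0 ⁵ * q (ι 0))         ≡⟨ cong₂ _*_ (sign-def 0) (cong₂ (λ x y → x ⁵ * q y) 1/C₀ ι0≡0) ⟩
  1ℚ * (1ℚ ⁵ * q 0ℚ)                   ≡⟨⟩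
  - fromℤ (+ 231168)                   ∎
  where
  open ≡-Reasoning
  1/C₀ : 1/C 0 ≡ 1ℚ
  1/C₀ = begin
    ι 1 * ι 1 * inv! 0   ≡⟨ cong (λ x → x * ι 1 * inv! 0) ι1≡1 ⟩
    1ℚ * ι 1 * inv! 0    ≡⟨ cong (_* inv! 0) (ℚ.*-identityˡ (ι 1)) ⟩
    ι 1 * inv! 0         ≡⟨ ℚ.*-comm (ι 1) (inv! 0) ⟩
    inv! 0 * ι 1         ≡⟨ inv!-inverseˡ 0 ⟩
    1ℚ                   ∎

error : ℕ → ℚ
error n = 5ℚ * partialSum T n ℚ.- fromℤ (+ 231168) + fromℤ (+ 64) * partialSum ζ3-term n

-- The edges n = 0 and k = 0 cancel against the partial sums of ζ(3) and of the series, and D 0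
-- cancels 231168. Only the two far edges and D n survive.
error≡ : ∀ n → error n ≡
  D n + fromℤ (+ 32) * (partialSum (F n) n ℚ.- partialSum (λ j → G j n) n)
error≡ n = begin
  5ℚ * partialSum T n ℚ.- k + fromℤ (+ 64) * Z
    ≡⟨ cong₂ (λ x y → x ℚ.- k + y) (trans (ΣT n) (cong (λ d → - (fromℤ (+ 32) * Y) + (D n ℚ.- d)) D₀)) 64Z≡ ⟩
  - (fromℤ (+ 32) * Y) + (D n ℚ.- - k) ℚ.- k + fromℤ (+ 32) * Φ₀
    ≡⟨ solve 5 (λ k y d a x → let c = con (fromℤ (+ 32)) in
         :- (c :* y) :+ (d :- :- k) :- k :+ c :* a := d :+ c :* (x :- (x :- a) :- y)) refl k Y (D n) Φ₀ Φ ⟩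
  D n + fromℤ (+ 32) * (Φ ℚ.- (Φ ℚ.- Φ₀) ℚ.- Y)
    ≡⟨ cong (λ x → D n + fromℤ (+ 32) * (Φ ℚ.- x ℚ.- Y)) (rectangle n n) ⟩
  D n + fromℤ (+ 32) * (Φ ℚ.- (X ℚ.- Y) ℚ.- Y)
    ≡⟨ solve 4 (λ d x y a → let c = con (fromℤ (+ 32)) in
         d :+ c :* (a :- (x :- y) :- y) := d :+ c :* (a :- x)) refl (D n) X Y Φ ⟩
  D n + fromℤ (+ 32) * (Φ ℚ.- X) ∎
  where
  open ≡-Reasoning
  k = fromℤ (+ 231168)
  Z = partialSum ζ3-term n
  Y = partialSum (λ j → G j 0) n
  X = partialSum (λ j → G j n) n
  Φ = partialSum (F n) n
  Φ₀ = partialSum (F 0) n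
  64Z≡ : fromℤ (+ 64) * Z ≡ fromℤ (+ 32) * Φ₀
  64Z≡ = begin
    fromℤ (+ 64) * Z             ≡⟨ solve 1 (λ z → con (fromℤ (+ 64)) :* z := con (fromℤ (+ 32)) :* (con 2ℚ :* z)) refl Z ⟩
    fromℤ (+ 32) * (2ℚ * Z)      ≡⟨ cong (fromℤ (+ 32) *_) (trans (partialSum-cong F₀≡2ζ3-term n) (partialSum-* 2ℚ ζ3-term n)) ⟨
    fromℤ (+ 32) * Φ₀            ∎

-- Each far edge has n terms of order c², and nc ≤ 1, so it contributes order c. The constant is
-- 18082048 + 32 · (2 + 32).
∣error∣≤ : ∀ n → ℚ.∣ error n ∣ ≤ ι 18083136 * recip (suc n)
∣error∣≤ n = begin
  ℚ.∣ error n ∣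
    ≡⟨ cong ℚ.∣_∣ (error≡ n) ⟩
  ℚ.∣ D n + fromℤ (+ 32) * (Φ ℚ.- X) ∣
    ≤⟨ ℚ.∣p+q∣≤∣p∣+∣q∣ (D n) _ ⟩
  ℚ.∣ D n ∣ + ℚ.∣ fromℤ (+ 32) * (Φ ℚ.- X) ∣
    ≡⟨ cong (λ x → ℚ.∣ D n ∣ + x) (ℚ.∣p*q∣≡∣p∣*∣q∣ (fromℤ (+ 32)) (Φ ℚ.- X)) ⟩
  ℚ.∣ D n ∣ + fromℤ (+ 32) * ℚ.∣ Φ ℚ.- X ∣
    ≤⟨ ℚ.+-mono-≤ (∣D∣≤ n) (ℚ.*-monoˡ-≤-nonNeg (fromℤ (+ 32)) (ℚ.≤-trans (ℚ.∣p-q∣≤∣p∣+∣q∣ Φ X)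
         (ℚ.+-mono-≤ (∣partialSum∣≤ (λ k → ∣F∣≤ n k n (ℕ.≤-trans (n≤double n) (ℕ.m≤m+n (double n) k))) n)
                     (∣partialSum∣≤ (λ j → ∣G∣≤ j n n (ℕ.m≤n+m n (double j))) n)))) ⟩
  fromℤ (+ 18082048) * c + fromℤ (+ 32) * (ι n * (2ℚ * (c * c)) + ι n * (fromℤ (+ 32) * (c * c)))
    ≡⟨ solve 2 (λ x c → con (fromℤ (+ 18082048)) :* c :+ con (fromℤ (+ 32)) :*
           (x :* (con 2ℚ :* (c :* c)) :+ x :* (con (fromℤ (+ 32)) :* (c :* c)))
         := con (fromℤ (+ 18082048)) :* c :+ con (fromℤ (+ 1088)) :* (c :* x :* c)) refl (ι n) c ⟩
  fromℤ (+ 18082048) * c + fromℤ (+ 1088) * (c * ι n * c)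
    ≤⟨ ℚ.+-monoʳ-≤ (fromℤ (+ 18082048) * c) (ℚ.*-monoˡ-≤-nonNeg (fromℤ (+ 1088))
         (ℚ.*-monoʳ-≤-nonNeg c {{c≥0}} cn≤1)) ⟩
  fromℤ (+ 18082048) * c + fromℤ (+ 1088) * (1ℚ * c)
    ≡⟨ solve 1 (λ c → con (fromℤ (+ 18082048)) :* c :+ con (fromℤ (+ 1088)) :* (con 1ℚ :* c)
         := con (fromℤ (+ 18083136)) :* c) refl c ⟩
  fromℤ (+ 18083136) * c
    ≡⟨ cong (_* c) (ι-def 18083136) ⟨
  ι 18083136 * c ∎
  where
  open ℚ.≤-Reasoning
  c = recip (suc n)
  c≥0 = ℚ.nonNegative (0≤recip (suc n))
  X = partialSum (λ j → G j n) n
  Φ = partialSum (F n) n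
  cn≤1 : c * ι n ≤ 1ℚ
  cn≤1 = ℚ.≤-trans (ℚ.*-monoˡ-≤-nonNeg c {{c≥0}} (ι-mono-≤ (ℕ.n≤1+n n))) (ℚ.≤-reflexive (recip-inverseˡ (suc n)))

-- Passage to the limit

archimedean : ∀ K ε → 0ℚ ℚ.< ε → ∃[ N ] (∀ n → N ℕ.≤ n → ι K * recip (suc n) ≤ ε)
-- A positive rational with denominator d is at least 1/d, so N = Kd works.
archimedean K ε@record{} 0<ε = K ℕ.* d , λ n N≤n → let c = recip (suc n); c≥0 = ℚ.nonNegative (0≤recip (suc n)) in begin
  ι K * c                       ≡⟨ ℚ.*-identityʳ (ι K * c) ⟨
  ι K * c * 1ℚ                  ≤⟨ ℚ.*-monoˡ-≤-nonNeg (ι K * c) {{ℚ.nonNegative (0≤* (0≤ι K) (0≤recip (suc n)))}} 1≤ε*d ⟩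
  ι K * c * (ε * ι d)           ≡⟨ solve 4 (λ k c e d → k :* c :* (e :* d) := e :* (c :* (k :* d))) refl (ι K) c ε (ι d) ⟩
  ε * (c * (ι K * ι d))         ≡⟨ cong (λ x → ε * (c * x)) (ι-* K d) ⟨
  ε * (c * ι (K ℕ.* d))         ≤⟨ ℚ.*-monoˡ-≤-nonNeg ε {{ℚ.nonNegative (ℚ.<⇒≤ 0<ε)}}
                                     (ℚ.*-monoˡ-≤-nonNeg c {{c≥0}} (ι-mono-≤ (ℕ.m≤n⇒m≤1+n N≤n))) ⟩
  ε * (c * ι (suc n))           ≡⟨ cong (ε *_) (recip-inverseˡ (suc n)) ⟩
  ε * 1ℚ                        ≡⟨ ℚ.*-identityʳ ε ⟩
  ε                             ∎
  where
  open ℚ.≤-Reasoning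
  d = ℚ.↧ₙ ε
  1≤ε*d : 1ℚ ≤ ε * ι d
  1≤ε*d = begin
    1ℚ                             ≤⟨ fromℤ-mono-≤ (ℤ.i<j⇒suc[i]≤j (ℤ.positive⁻¹ (ℚ.↥ ε) {{ℚ.positive 0<ε}})) ⟩
    fromℤ (ℚ.↥ ε)                  ≡⟨ /-*-cancel (ℚ.↥ ε) d ⟨
    (ℚ.↥ ε ℚ./ d) * fromℤ (+ d)    ≡⟨ cong₂ _*_ (ℚ.↥p/↧p≡p ε) (sym (ι-def d)) ⟩
    ε * ι d                        ∎

summand : ℕ → ℚ
summand k =
  ℚ._/_ (-1ℤ ℤ.^ k) (centralBinomial k ℕ.^ 5) {{centralBinomial^≢0 k 5}} ℚ.*
    fromℤ (+ 684700 ℤ.* (+ k) ℤ.^ 4 ℤ.- + 1418358 ℤ.* (+ k) ℤ.^ 3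
      ℤ.+ + 1100639 ℤ.* (+ k) ℤ.^ 2 ℤ.- + 365392 ℤ.* + k ℤ.+ + 47327)

-- Here n truncates the series, while m runs through the sequence representing the limit. Since
-- `error n` uses one truncation for both sums, the mismatch 64(Zm - Zn) appears; each of the two
-- contributions is at most ε before the factor 1/5.
distance≤ : ∀ ε m n → ι 18083136 * recip (suc n) ≤ ε →
  ℚ.∣ partialSum ζ3-term m ℚ.- partialSum ζ3-term n ∣ ≤ + 1 ℚ./ 64 * ε →
  ℚ.∣ partialSum summand n ℚ.- + 1 ℚ./ 5 * (fromℤ (+ 231168) ℚ.- fromℤ (+ 64) * partialSum ζ3-term m) ∣
    ≤ + 2 ℚ./ 5 * ε
distance≤ ε m n error≤ε Zm-Zn≤ = begin
  ℚ.∣ partialSum summand n ℚ.- + 1 ℚ./ 5 * (k ℚ.- fromℤ (+ 64) * Zm) ∣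
    ≡⟨ cong (λ x → ℚ.∣ x ℚ.- + 1 ℚ./ 5 * (k ℚ.- fromℤ (+ 64) * Zm) ∣) (partialSum-cong summand≡T n) ⟩
  ℚ.∣ S ℚ.- + 1 ℚ./ 5 * (k ℚ.- fromℤ (+ 64) * Zm) ∣
    ≡⟨ cong ℚ.∣_∣ (solve 4 (λ s k z z′ →
         s :- con (+ 1 ℚ./ 5) :* (k :- con (fromℤ (+ 64)) :* z′)
         := con (+ 1 ℚ./ 5) :* ((con 5ℚ :* s :- k :+ con (fromℤ (+ 64)) :* z) :+ con (fromℤ (+ 64)) :* (z′ :- z)))
         refl S k Zn Zm) ⟩
  ℚ.∣ + 1 ℚ./ 5 * (error n + fromℤ (+ 64) * (Zm ℚ.- Zn)) ∣
    ≡⟨ ℚ.∣p*q∣≡∣p∣*∣q∣ (+ 1 ℚ./ 5) (error n + fromℤ (+ 64) * (Zm ℚ.- Zn)) ⟩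
  + 1 ℚ./ 5 * ℚ.∣ error n + fromℤ (+ 64) * (Zm ℚ.- Zn) ∣
    ≤⟨ ℚ.*-monoˡ-≤-nonNeg (+ 1 ℚ./ 5) (ℚ.≤-trans (ℚ.∣p+q∣≤∣p∣+∣q∣ (error n) _)
         (ℚ.+-mono-≤ (ℚ.≤-trans (∣error∣≤ n) error≤ε)
           (subst (_≤ fromℤ (+ 64) * (+ 1 ℚ./ 64 * ε)) (sym (ℚ.∣p*q∣≡∣p∣*∣q∣ (fromℤ (+ 64)) (Zm ℚ.- Zn)))
             (ℚ.*-monoˡ-≤-nonNeg (fromℤ (+ 64)) Zm-Zn≤)))) ⟩
  + 1 ℚ./ 5 * (ε + fromℤ (+ 64) * (+ 1 ℚ./ 64 * ε))
    ≡⟨ solve 1 (λ e → con (+ 1 ℚ./ 5) :* (e :+ con (fromℤ (+ 64)) :* (con (+ 1 ℚ./ 64) :* e))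
         := con (+ 2 ℚ./ 5) :* e) refl ε ⟩
  + 2 ℚ./ 5 * ε ∎
  where
  open ℚ.≤-Reasoning
  k = fromℤ (+ 231168)
  S = partialSum T n
  Zm = partialSum ζ3-term m
  Zn = partialSum ζ3-term n

*-pos : ∀ q .{{_ : ℚ.Positive q}} ε → 0ℚ ℚ.< ε → 0ℚ ℚ.< q * ε
*-pos q ε 0<ε = subst (ℚ._< q * ε) (ℚ.*-zeroʳ q) (ℚ.*-monoʳ-<-pos q 0<ε)

theorem1p3 : HasSum
    (λ k →
    ℚ._/_ (-1ℤ ℤ.^ k) (centralBinomial k ℕ.^ 5) {{centralBinomial^≢0 k 5}} ℚ.*
    fromℤ (+ 684700 ℤ.* (+ k) ℤ.^ 4 ℤ.- + 1418358 ℤ.* (+ k) ℤ.^ 3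
    ℤ.+ + 1100639 ℤ.* (+ k) ℤ.^ 2 ℤ.- + 365392 ℤ.* + k ℤ.+ + 47327))
    ((+ 1 ℚ./ 5) · (fromℚ (fromℤ (+ 231168)) - fromℤ (+ 64) · ζ3))
theorem1p3 ε 0<ε =
  let M , ζ3-cauchy = cauchy ζ3 (+ 1 ℚ./ 64 * ε) (*-pos (+ 1 ℚ./ 64) ε 0<ε)
      N , error≤ε   = archimedean 18083136 ε 0<ε
  in M ℕ.⊔ N , λ n M⊔N≤n →
    -- The distance is at most 2ε/5, so 3ε/5 is available as the uniform gap required by `<`.
    + 3 ℚ./ 5 * ε , *-pos (+ 3 ℚ./ 5) ε 0<ε , M , λ m M≤m →
      subst (ℚ.∣ partialSum summand n ℚ.-
                 + 1 ℚ./ 5 * (fromℤ (+ 231168) ℚ.- fromℤ (+ 64) * partialSum ζ3-term m) ∣ + + 3 ℚ./ 5 * ε ≤_)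
        (solve 1 (λ e → con (+ 2 ℚ./ 5) :* e :+ con (+ 3 ℚ./ 5) :* e := e) refl ε)
        (ℚ.+-monoˡ-≤ (+ 3 ℚ./ 5 * ε) (distance≤ ε m n
          (error≤ε n (ℕ.m⊔n≤o⇒n≤o M N M⊔N≤n))
          (ℚ.<⇒≤ (ζ3-cauchy m n M≤m (ℕ.m⊔n≤o⇒m≤o M N M⊔N≤n)))))
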